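{- For all $x_1,x_2\ge 0$ with $x_1+x_2\le 1$, $$C_\infty(x_1,x_2)\le\begin{cases}2.014096 & \text{if } x_1,x_2\le 6/11,\\ 11/12 & \text{otherwise.}\end{cases}$$
   Context: The $k$-simplex is $\{x\in\mathbb{R}^k: x\ge 0,\ \sum_i x_i=1\}$. Let $F(z)=\min\{(11/6)z,1\}$ for $z\in[0,1]$, and let $F'(z)=11/6$ for $z\in[0,6/11]$ and $F'(z)=0$ otherwise. For a point $(x_1,\dots,x_k)$ of the $k$-simplex define $$d_k(x_1,\ldots,x_k)=\frac{1}{k!}\sum_{\sigma}\Big(F'(x_1)\prod_{i:\sigma(i)<\sigma(1)}[1-F(x_i)]+F'(x_2)\prod_{i:\sigma(i)<\sigma(2)}[1-F(x_i)]\Big),$$ the sum being over all permutations $\sigma$ of $\{1,\dots,k\}$. For $k\ge 3$ and $x_1,x_2\ge0$ with $x_1+x_2\le1$ define $C_k(x_1,x_2)=d_k(x_1,x_2,c,\ldots,c)$ where $c=(1-x_1-x_2)/(k-2)$, and $C_\infty(x_1,x_2)=\lim_{k\to\infty}C_k(x_1,x_2)$ (this limit exists, since for $k\ge4$ the sequence is nondecreasing in $k$ and it is bounded). -}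

module Defs where

open import Level using (Level; _⊔_) renaming (suc to lsuc)
open import Algebra.Bundles using (CommutativeRing)
import Algebra.Construct.NaturalChoice.Max as Max
import Algebra.Construct.NaturalChoice.Min as Min
import Algebra.Definitions.RawMonoid as RawMonoidDefinitions
open import Data.Fin.Base as Fin using (Fin)
open import Data.Fin.Patterns using (0F; 1F)
open import Data.Fin.Permutation as Perm using (Permutation′; _⟨$⟩ʳ_)
import Data.Fin.Properties as Fin
open import Data.List.Base using (List; []; _∷_; map; foldr; filter; allFin; cartesianProductWith; length)
open import Data.List.Membership.Propositional using (_∈_)
open import Data.List.Membership.Propositional.Properties using (∈-allFin; ∈-cartesianProductWith⁺)
open import Data.List.Properties using (length-++; length-map; length-tabulate)
open import Data.List.Relation.Unary.Any using (here)
open import Data.Nat.Base as ℕ using (ℕ; zero; suc; _!)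
open import Data.Product.Base using (Σ-syntax; ∃-syntax; _×_; _,_)
open import Function.Base using (id)
open import Relation.Binary.Bundles using (TotalOrder)
import Relation.Binary.Construct.NonStrictToStrict as NonStrictToStrict
open import Relation.Binary.Core using (Rel)
open import Relation.Binary.PropositionalEquality using (_≡_; refl; sym; trans; cong; cong₂)
open import Relation.Binary.Structures using (IsDecTotalOrder)
open import Relation.Nullary using (¬_; yes; no)
open import Relation.Unary using (Pred; Satisfiable)

-- The real numbers, given axiomatically as a Dedekind-complete ordered field.
-- The order is decidable, as it is classically; F′ below is discontinuous and
-- needs this to be a function.
record CompleteOrderedField (c ℓ₁ ℓ₂ : Level) : Set (lsuc (c ⊔ ℓ₁ ⊔ ℓ₂)) where
  infix  4 _≤_
  infixl 8 _⁻¹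
  field
    commutativeRing : CommutativeRing c ℓ₁

  open CommutativeRing commutativeRing public

  field
    _≤_             : Rel Carrier ℓ₂
    -- Total for convenience; 0# ⁻¹ is unspecified.
    _⁻¹             : Carrier → Carrier
    0≉1             : ¬ (0# ≈ 1#)
    ⁻¹-inverseʳ     : ∀ x → ¬ (x ≈ 0#) → x * x ⁻¹ ≈ 1#
    isDecTotalOrder : IsDecTotalOrder _≈_ _≤_
    +-monoʳ-≤       : ∀ x {y z} → y ≤ z → x + y ≤ x + z
    *-nonNegative   : ∀ {x y} → 0# ≤ x → 0# ≤ y → 0# ≤ x * y

  UpperBound : Pred Carrier (c ⊔ ℓ₁ ⊔ ℓ₂) → Carrier → Set (c ⊔ ℓ₁ ⊔ ℓ₂)
  UpperBound P u = ∀ x → P x → x ≤ u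

  field
    supremum : ∀ (P : Pred Carrier (c ⊔ ℓ₁ ⊔ ℓ₂)) → Satisfiable P → (∃[ u ] UpperBound P u) →
               ∃[ s ] (UpperBound P s × (∀ u → UpperBound P u → s ≤ u))

  open IsDecTotalOrder isDecTotalOrder public
    using (_≤?_; isTotalOrder)

  totalOrder : TotalOrder c ℓ₁ ℓ₂
  totalOrder = record { isTotalOrder = isTotalOrder }

  open NonStrictToStrict _≈_ _≤_ public using (_<_)

-- permutations k lists every permutation of Fin k exactly once: a permutation
-- of Fin (suc k) is determined by the image j of 0F and by the permutation of
-- Fin k that remains when 0F and j are removed.
permutations : ∀ k → List (Permutation′ k)
permutations zero    = Perm.id ∷ []
permutations (suc k) = cartesianProductWith (Perm.insert 0F) (allFin (suc k)) (permutations k)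

private
  length-product : ∀ {A B C : Set} (f : A → B → C) xs ys →
                   length (cartesianProductWith f xs ys) ≡ length xs ℕ.* length ys
  length-product f []       ys = refl
  length-product f (x ∷ xs) ys = trans (length-++ (map (f x) ys))
    (cong₂ ℕ._+_ (length-map (f x) ys) (length-product f xs ys))

-- Together, this and permutations-complete say that no permutation is missed or repeated.
permutations-length : ∀ k → length (permutations k) ≡ k !
permutations-length zero    = refl
permutations-length (suc k) = trans
  (length-product (Perm.insert 0F) (allFin (suc k)) (permutations k))
  (cong₂ ℕ._*_ (length-tabulate {n = suc k} id) (permutations-length k))

permutations-complete : ∀ k (π : Permutation′ k) → Σ[ ρ ∈ Permutation′ k ] (ρ ∈ permutations k × ρ Perm.≈ π)
permutations-complete zero    π = Perm.id , here refl , λ ()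
permutations-complete (suc k) π with permutations-complete k (Perm.remove 0F π)
... | ρ , ρ∈ , ρ≈ =
  Perm.insert 0F (π ⟨$⟩ʳ 0F) ρ ,
  ∈-cartesianProductWith⁺ (Perm.insert 0F) (∈-allFin (π ⟨$⟩ʳ 0F)) ρ∈ ,
  λ { 0F          → refl
    ; (Fin.suc i) → trans (cong (Fin.punchIn (π ⟨$⟩ʳ 0F)) (ρ≈ i))
                          (sym (Perm.punchIn-permute π 0F i)) }

module Real {c ℓ₁ ℓ₂} (ℝ : CompleteOrderedField c ℓ₁ ℓ₂) where
  open CompleteOrderedField ℝ
  open RawMonoidDefinitions +-rawMonoid using () renaming (_×_ to _·_)
  open Min totalOrder using (_⊓_)
  open Max totalOrder using () renaming (_⊔_ to _∨_)

  fromℕ : ℕ → Carrier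
  fromℕ n = n · 1#

  infixl 7 _/_
  _/_ : ℕ → ℕ → Carrier
  m / n = fromℕ m * fromℕ n ⁻¹

  ∣_∣ : Carrier → Carrier
  ∣ x ∣ = x ∨ (- x)

  _⟶_ : (ℕ → Carrier) → Carrier → Set (c ⊔ ℓ₁ ⊔ ℓ₂)
  a ⟶ L = ∀ ε → 0# < ε → ∃[ N ] (∀ n → N ℕ.≤ n → ∣ a n - L ∣ < ε)

  ∑ : ∀ {a} {A : Set a} → List A → (A → Carrier) → Carrier
  ∑ xs f = foldr _+_ 0# (map f xs)

  ∏ : ∀ {a} {A : Set a} → List A → (A → Carrier) → Carrier
  ∏ xs f = foldr _*_ 1# (map f xs)

  F : Carrier → Carrier
  F z = (11 / 6 * z) ⊓ 1#

  F′ : Carrier → Carrier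
  F′ z with z ≤? 6 / 11
  ... | yes _ = 11 / 6
  ... | no  _ = 0#

  before : ∀ {k} → Permutation′ k → Fin k → List (Fin k)
  before {k} σ j = filter (λ i → (σ ⟨$⟩ʳ i) Fin.<? (σ ⟨$⟩ʳ j)) (allFin k)

  -- d m is d_k for k = 2 + m; the coordinates x₁, x₂ are x 0F, x 1F.
  d : ∀ m → (Fin (2 ℕ.+ m) → Carrier) → Carrier
  d m x = fromℕ ((2 ℕ.+ m) !) ⁻¹ * ∑ (permutations (2 ℕ.+ m)) λ σ →
            F′ (x 0F) * ∏ (before σ 0F) (λ i → 1# - F (x i)) +
            F′ (x 1F) * ∏ (before σ 1F) (λ i → 1# - F (x i))

  -- C m is C_k for k = 3 + m, so that k - 2 = 1 + m.
  C : ℕ → Carrier → Carrier → Carrier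
  C m x₁ x₂ = d (suc m) point
    where
    point : Fin (3 ℕ.+ m) → Carrier
    point 0F                    = x₁
    point 1F                    = x₂
    point (Fin.suc (Fin.suc _)) = (1# - x₁ - x₂) * fromℕ (suc m) ⁻¹

  -- L is C_∞(x₁, x₂).
  IsC∞ : Carrier → Carrier → Carrier → Set (c ⊔ ℓ₁ ⊔ ℓ₂)
  IsC∞ x₁ x₂ L = (λ m → C m x₁ x₂) ⟶ L

{-# OPTIONS --safe #-}

-- Write a = 11/6, s = 1 - x₁ - x₂, y = a s, n = k - 2, h = y/n. Counting permutations by the positions of
-- the first two coordinates turns (n+1)(n+2) C_k into F′(x₁) A(1 - F(x₂)) + F′(x₂) A(1 - F(x₁)), where
--   A(w) = Σ_{j ≤ n} (1 - h)^j ((j+1) w + (n+1-j)).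
-- If x₁ or x₂ exceeds 6/11, one summand vanishes and the other has w = 0, and (1 - h)^j ≤ 1 gives a/2.
-- Otherwise (1 - h)^j is bounded by the Bonferroni truncation Σ_{i ≤ 6} (-h)^i (j choose i), whose weighted
-- sums over j are explicit by hockey-stick identities. As h → 0 this leaves a polynomial of degree 7 in
-- y ∈ [0, 2], whose maximum is below 2.014096 by about 10⁻⁶; the margin absorbs the error for k > 2 ∙ 10⁹.
module Submission where

open import Defs
import Algebra.Construct.NaturalChoice.Max as Max
import Algebra.Construct.NaturalChoice.Min as Min
import Algebra.Properties.AbelianGroup as AbelianGroupProperties
import Algebra.Properties.Monoid.Mult as MonoidMult
import Algebra.Properties.Ring as RingProperties
import Algebra.Properties.Semiring.Exp as Exp
import Algebra.Properties.Semiring.Mult as SemiringMult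
import Algebra.Solver.Ring as RingSolver
open import Algebra.Solver.Ring.AlmostCommutativeRing using (_-Raw-AlmostCommutative⟶_; fromCommutativeRing; Induced-equivalence)
open import Data.Bool.Base using (Bool; true; false; if_then_else_)
open import Data.Fin.Base as Fin using (Fin; toℕ; punchIn)
open import Data.Fin.Patterns using (0F; 1F)
open import Data.Fin.Permutation as Perm using (Permutation′; _⟨$⟩ʳ_)
import Data.Fin.Properties as Fin
open import Data.Integer.Base as ℤ using (ℤ; +_; -[1+_]; +0; +[1+_]; _⊖_; _◃_)
import Data.Integer.Properties as ℤ
open import Data.List.Base using (List; []; _∷_; _++_; map; foldr; filter; allFin; cartesianProductWith)
open import Data.List.Properties using (map-tabulate)
open import Data.Maybe.Base using (just; nothing)
open import Data.Nat.Base as ℕ using (ℕ; zero; suc; pred; _!; _<ᵇ_; z≤n; s≤s)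
import Data.Nat.Divisibility as ℕ
import Data.Nat.DivMod as ℕ
import Data.Nat.Properties as ℕ
open import Data.Product.Base using (_×_; _,_; _,′_; proj₁; proj₂; ∃-syntax)
import Data.Sign.Base as Sign
open import Data.Sum.Base using (inj₁; inj₂)
open import Data.Vec.Base using (Vec; []; _∷_)
open import Function.Base using (_∘_; id; case_of_)
open import Relation.Binary.Bundles using (TotalOrder)
open import Relation.Binary.Definitions using (WeaklyDecidable)
open import Relation.Binary.PropositionalEquality as ≡ using (_≡_)
import Relation.Binary.Reasoning.PartialOrder as PartialOrderReasoning
import Relation.Binary.Reasoning.Setoid as SetoidReasoning
open import Relation.Nullary using (¬_; does; yes; no; contradiction)
open import Relation.Unary using (Decidable)

-- When both coordinates are at most 6/11, the weights enter only through their sum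
-- `2 - a (x₁ + x₂)`. Since `x₁ + x₂ = 1 - s`, this equals `1/6 + y`, and the two-variable problem
-- becomes one in `y` alone. The truncation has to be sharp. The limit comes within about 10⁻⁶ of
-- 2.014096 near y = 0.295, where stopping at i = 4 would already give about 2.014099. So i = 6 is
-- the first truncation from above that suffices. No exponential function is needed: for finite n,
-- the relation `n h = y` turns each binomial coefficient times `h ^ i` into a multiple of
-- `y (y - h) ... (y - (i-1) h)`. Replacing this product by `y ^ i` costs an explicit multiple of h.
-- The field is abstract, so numerals in it do not compute. Every inequality is therefore multiplied
-- by an integer that clears its denominators, and the arithmetic takes place in ℕ and ℤ.

-- Positions after an insertion

punchIn-<ᵇ-above : ∀ {k} (l : Fin (suc k)) (r : Fin k) {j} → j ℕ.≤ toℕ l →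
                   (toℕ (punchIn l r) <ᵇ j) ≡ (toℕ r <ᵇ j)
punchIn-<ᵇ-above l           r           {zero}  p       = ≡.refl
punchIn-<ᵇ-above (Fin.suc l) 0F          {suc j} (s≤s p) = ≡.refl
punchIn-<ᵇ-above (Fin.suc l) (Fin.suc r) {suc j} (s≤s p) = punchIn-<ᵇ-above l r p

-- One of the positions below `suc j` is `l` itself, which `punchIn l` skips, so `j` of them remain
-- for the others.
punchIn-<ᵇ-below : ∀ {k} (l : Fin (suc k)) (r : Fin k) {j} → toℕ l ℕ.≤ j →
                   (toℕ (punchIn l r) <ᵇ suc j) ≡ (toℕ r <ᵇ j)
punchIn-<ᵇ-below 0F          r           p       = ≡.refl
punchIn-<ᵇ-below (Fin.suc l) 0F          (s≤s p) = ≡.refl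
punchIn-<ᵇ-below (Fin.suc l) (Fin.suc r) (s≤s p) = punchIn-<ᵇ-below l r p

punchIn-<ᵇ-punchIn : ∀ {k} (l : Fin (suc k)) (r s : Fin k) →
                     (toℕ (punchIn l r) <ᵇ toℕ (punchIn l s)) ≡ (toℕ r <ᵇ toℕ s)
punchIn-<ᵇ-punchIn 0F          r           s           = ≡.refl
punchIn-<ᵇ-punchIn (Fin.suc l) 0F          0F          = ≡.refl
punchIn-<ᵇ-punchIn (Fin.suc l) 0F          (Fin.suc s) = ≡.refl
punchIn-<ᵇ-punchIn (Fin.suc l) (Fin.suc r) 0F          = ≡.refl
punchIn-<ᵇ-punchIn (Fin.suc l) (Fin.suc r) (Fin.suc s) = punchIn-<ᵇ-punchIn l r s

-- `punchIn l` moves `r` up exactly when `l ≤ r`, which is what the comparison with `suc (toℕ r)`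
-- tests.
<ᵇ-punchIn : ∀ {k} (l : Fin (suc k)) (r : Fin k) →
             (toℕ l <ᵇ toℕ (punchIn l r)) ≡ (toℕ l <ᵇ suc (toℕ r))
<ᵇ-punchIn 0F          r           = ≡.refl
<ᵇ-punchIn (Fin.suc l) 0F          = ≡.refl
<ᵇ-punchIn (Fin.suc l) (Fin.suc r) = <ᵇ-punchIn l r

<⇒<ᵇ-true : ∀ {m n} → m ℕ.< n → (m <ᵇ n) ≡ true
<⇒<ᵇ-true {zero}  {suc n} p       = ≡.refl
<⇒<ᵇ-true {suc m} {suc n} (s≤s p) = <⇒<ᵇ-true p

≥⇒<ᵇ-false : ∀ {m n} → n ℕ.≤ m → (m <ᵇ n) ≡ false
≥⇒<ᵇ-false z≤n     = ≡.refl
≥⇒<ᵇ-false (s≤s p) = ≥⇒<ᵇ-false p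

-- 8 ! times the coefficients, up to sign, of the second antiderivative of e^(-y).
coefficient : ℕ → ℕ
coefficient i = (8 ! ℕ./ (2 ℕ.+ i) !) {{(2 ℕ.+ i) ℕ.!≢0}}

coefficient-! : ∀ i → i ℕ.< 7 → coefficient i ℕ.* (2 ℕ.+ i) ! ≡ 8 !
coefficient-! i i<7 = ℕ.m/n*n≡m {{(2 ℕ.+ i) ℕ.!≢0}} (ℕ.m≤n⇒m!∣n! (s≤s i<7))

module Bounds {c ℓ₁ ℓ₂} (ℝ : CompleteOrderedField c ℓ₁ ℓ₂) where
  open CompleteOrderedField ℝ
  open Real ℝ renaming (∣_∣ to abs)
  open Exp semiring using (_^_)
  open Min totalOrder using (x⊓y≤y; ⊓-glb; x≤y⇒x⊓y≈x; x≤y⇒y⊓x≈x)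
  open TotalOrder totalOrder using (poset; total; antisym)
    renaming (refl to ≤-refl; reflexive to ≤-reflexive; trans to ≤-trans; ≤-respˡ-≈ to ≤-respˡ; ≤-respʳ-≈ to ≤-respʳ)
  open RingProperties ring using (-‿distribˡ-*; -‿distribʳ-*; -0#≈0#; -‿involutive)
  open AbelianGroupProperties +-abelianGroup using (⁻¹-∙-comm)
  module ≈-Reasoning = SetoidReasoning setoid
  module ≤-Reasoning = PartialOrderReasoning poset

  -- Ordered field arithmetic

  fromℕ-+ : ∀ m n → fromℕ (m ℕ.+ n) ≈ fromℕ m + fromℕ n
  fromℕ-+ = MonoidMult.×-homo-+ +-monoid 1#

  fromℕ-* : ∀ m n → fromℕ (m ℕ.* n) ≈ fromℕ m * fromℕ n
  fromℕ-* = SemiringMult.×1-homo-* semiring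

  -- Supplies the ring solver with integer coefficients, whose equality computes, unlike that of the
  -- abstract field.
  fromℤ : ℤ → Carrier
  fromℤ (+ n)    = fromℕ n
  fromℤ -[1+ n ] = - fromℕ (suc n)

  private
    fromℤ-⊖ : ∀ m n → fromℤ (m ⊖ n) ≈ fromℕ m - fromℕ n
    fromℤ-⊖ zero    zero    = sym (-‿inverseʳ 0#)
    fromℤ-⊖ (suc m) zero    = sym (trans (+-congˡ -0#≈0#) (+-identityʳ _))
    fromℤ-⊖ zero    (suc n) = sym (+-identityˡ _)
    fromℤ-⊖ (suc m) (suc n) = begin
      fromℤ (suc m ⊖ suc n)                       ≡⟨ ≡.cong fromℤ (ℤ.[1+m]⊖[1+n]≡m⊖n m n) ⟩
      fromℤ (m ⊖ n)                               ≈⟨ fromℤ-⊖ m n ⟩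
      fromℕ m - fromℕ n                           ≈⟨ +-identityˡ _ ⟨
      0# + (fromℕ m - fromℕ n)                    ≈⟨ +-congʳ (-‿inverseʳ 1#) ⟨
      (1# - 1#) + (fromℕ m - fromℕ n)             ≈⟨ +-assoc _ _ _ ⟩
      1# + (- 1# + (fromℕ m - fromℕ n))           ≈⟨ +-congˡ (+-assoc _ _ _) ⟨
      1# + ((- 1# + fromℕ m) - fromℕ n)           ≈⟨ +-congˡ (+-congʳ (+-comm _ _)) ⟩
      1# + ((fromℕ m - 1#) - fromℕ n)             ≈⟨ +-congˡ (+-assoc _ _ _) ⟩
      1# + (fromℕ m + (- 1# - fromℕ n))           ≈⟨ +-assoc _ _ _ ⟨
      fromℕ (suc m) + (- 1# - fromℕ n)            ≈⟨ +-congˡ (⁻¹-∙-comm 1# (fromℕ n)) ⟩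
      fromℕ (suc m) - fromℕ (suc n)               ∎
      where open ≈-Reasoning

    fromℤ-neg : ∀ i → fromℤ (ℤ.- i) ≈ - fromℤ i
    fromℤ-neg +0       = sym -0#≈0#
    fromℤ-neg +[1+ n ] = refl
    fromℤ-neg -[1+ n ] = sym (-‿involutive _)

    fromℤ-+ : ∀ i j → fromℤ (i ℤ.+ j) ≈ fromℤ i + fromℤ j
    fromℤ-+ (+ m)    (+ n)    = fromℕ-+ m n
    fromℤ-+ (+ m)    -[1+ n ] = fromℤ-⊖ m (suc n)
    fromℤ-+ -[1+ m ] (+ n)    = trans (fromℤ-⊖ n (suc m)) (+-comm _ _)
    fromℤ-+ -[1+ m ] -[1+ n ] = begin
      - fromℕ (suc (suc (m ℕ.+ n)))     ≡⟨ ≡.cong (λ k → - fromℕ (suc k)) (ℕ.+-suc m n) ⟨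
      - fromℕ (suc m ℕ.+ suc n)         ≈⟨ -‿cong (fromℕ-+ (suc m) (suc n)) ⟩
      - (fromℕ (suc m) + fromℕ (suc n)) ≈⟨ ⁻¹-∙-comm _ _ ⟨
      - fromℕ (suc m) - fromℕ (suc n)   ∎
      where open ≈-Reasoning

    fromℤ-◃ : ∀ n → fromℤ (Sign.- ◃ n) ≈ - fromℕ n
    fromℤ-◃ zero    = sym -0#≈0#
    fromℤ-◃ (suc n) = refl

    fromℤ-* : ∀ i j → fromℤ (i ℤ.* j) ≈ fromℤ i * fromℤ j
    fromℤ-* (+ m)    (+ n)    = trans (reflexive (≡.cong fromℤ (ℤ.+◃n≡+n (m ℕ.* n)))) (fromℕ-* m n)
    fromℤ-* (+ m)    -[1+ n ] = trans (fromℤ-◃ (m ℕ.* suc n)) (trans (-‿cong (fromℕ-* m (suc n))) (-‿distribʳ-* _ _))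
    fromℤ-* -[1+ m ] (+ n)    = trans (fromℤ-◃ (suc m ℕ.* n)) (trans (-‿cong (fromℕ-* (suc m) n)) (-‿distribˡ-* _ _))
    fromℤ-* -[1+ m ] -[1+ n ] = begin
      fromℕ (suc m ℕ.* suc n)             ≈⟨ fromℕ-* (suc m) (suc n) ⟩
      fromℕ (suc m) * fromℕ (suc n)       ≈⟨ -‿involutive _ ⟨
      - - (fromℕ (suc m) * fromℕ (suc n)) ≈⟨ -‿cong (-‿distribˡ-* _ _) ⟩
      - (- fromℕ (suc m) * fromℕ (suc n)) ≈⟨ -‿distribʳ-* _ _ ⟩
      - fromℕ (suc m) * - fromℕ (suc n)   ∎
      where open ≈-Reasoning

    fromℤ-homo : ℤ.+-*-rawRing -Raw-AlmostCommutative⟶ fromCommutativeRing commutativeRing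
    fromℤ-homo = record
      { ⟦_⟧    = fromℤ
      ; +-homo = fromℤ-+
      ; *-homo = fromℤ-*
      ; -‿homo = fromℤ-neg
      ; 0-homo = refl
      ; 1-homo = +-identityʳ 1#
      }

    fromℤ-≟ : WeaklyDecidable (Induced-equivalence fromℤ-homo)
    fromℤ-≟ i j with i ℤ.≟ j
    ... | yes i≡j = just (reflexive (≡.cong fromℤ i≡j))
    ... | no  _   = nothing

  module Solver = RingSolver ℤ.+-*-rawRing (fromCommutativeRing commutativeRing) fromℤ-homo fromℤ-≟

  open Solver using (Polynomial; ⟦_⟧; ⟦_⟧N; normalise; correct; var; con; solve; _:=_; _:+_; _:*_; _:-_; _:^_; :-_)

  -- Denotes 1# on the nose, whereas con (+ 1) denotes 1# + 0#.
  :1 : ∀ {n} → Polynomial n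
  :1 = con (+ 0) :^ 0

  x≤y⇒0≤y-x : ∀ {x y} → x ≤ y → 0# ≤ y - x
  x≤y⇒0≤y-x {x} {y} x≤y = begin
    0#       ≈⟨ -‿inverseˡ x ⟨
    - x + x  ≤⟨ +-monoʳ-≤ (- x) x≤y ⟩
    - x + y  ≈⟨ +-comm _ _ ⟩
    y - x    ∎
    where open ≤-Reasoning

  ≤-by : ∀ {x y} z → 0# ≤ z → y ≈ x + z → x ≤ y
  ≤-by {x} {y} z 0≤z y≈x+z = begin
    x      ≈⟨ +-identityʳ x ⟨
    x + 0# ≤⟨ +-monoʳ-≤ x 0≤z ⟩
    x + z  ≈⟨ y≈x+z ⟨
    y      ∎
    where open ≤-Reasoning

  0≤y-x⇒x≤y : ∀ {x y} → 0# ≤ y - x → x ≤ y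
  0≤y-x⇒x≤y {x} {y} 0≤y-x = ≤-by (y - x) 0≤y-x
    (solve 2 (λ x y → y := x :+ (y :- x)) refl x y)

  +-nonNegative : ∀ {x y} → 0# ≤ x → 0# ≤ y → 0# ≤ x + y
  +-nonNegative {x} {y} 0≤x 0≤y = ≤-trans 0≤x (≤-by y 0≤y refl)

  +-mono-≤ : ∀ {x y u v} → x ≤ y → u ≤ v → x + u ≤ y + v
  +-mono-≤ {x} {y} {u} {v} x≤y u≤v = ≤-by ((y - x) + (v - u))
    (+-nonNegative (x≤y⇒0≤y-x x≤y) (x≤y⇒0≤y-x u≤v))
    (solve 4 (λ x y u v → y :+ v := (x :+ u) :+ ((y :- x) :+ (v :- u))) refl x y u v)

  *-monoʳ-≤ : ∀ {x y z} → 0# ≤ z → x ≤ y → z * x ≤ z * y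
  *-monoʳ-≤ {x} {y} {z} 0≤z x≤y = ≤-by (z * (y - x)) (*-nonNegative 0≤z (x≤y⇒0≤y-x x≤y))
    (solve 3 (λ x y z → z :* y := z :* x :+ z :* (y :- x)) refl x y z)

  *-monoˡ-≤ : ∀ {x y z} → 0# ≤ z → x ≤ y → x * z ≤ y * z
  *-monoˡ-≤ 0≤z x≤y = ≤-respˡ (*-comm _ _) (≤-respʳ (*-comm _ _) (*-monoʳ-≤ 0≤z x≤y))

  *-mono-≤ : ∀ {x y u v} → 0# ≤ x → 0# ≤ v → x ≤ y → u ≤ v → x * u ≤ y * v
  *-mono-≤ 0≤x 0≤v x≤y u≤v = ≤-trans (*-monoʳ-≤ 0≤x u≤v) (*-monoˡ-≤ 0≤v x≤y)

  square-nonNegative : ∀ x → 0# ≤ x * x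
  square-nonNegative x with total 0# x
  ... | inj₁ 0≤x = *-nonNegative 0≤x 0≤x
  ... | inj₂ x≤0 = ≤-respʳ (solve 1 (λ x → (con +0 :- x) :* (con +0 :- x) := x :* x) refl x)
                     (*-nonNegative (x≤y⇒0≤y-x x≤0) (x≤y⇒0≤y-x x≤0))

  0≤1 : 0# ≤ 1#
  0≤1 = ≤-respʳ (*-identityˡ 1#) (square-nonNegative 1#)

  fromℕ-nonNegative : ∀ n → 0# ≤ fromℕ n
  fromℕ-nonNegative zero    = ≤-refl
  fromℕ-nonNegative (suc n) = +-nonNegative 0≤1 (fromℕ-nonNegative n)

  fromℕ-mono-≤ : ∀ {m n} → m ℕ.≤ n → fromℕ m ≤ fromℕ n
  fromℕ-mono-≤ {n = n} ℕ.z≤n     = fromℕ-nonNegative n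
  fromℕ-mono-≤         (ℕ.s≤s p) = +-monoʳ-≤ 1# (fromℕ-mono-≤ p)

  fromℕ≉0 : ∀ n .{{_ : ℕ.NonZero n}} → ¬ (fromℕ n ≈ 0#)
  fromℕ≉0 (suc n) 1+n≈0 = 0≉1 (antisym 0≤1 (≤-trans (≤-by (fromℕ n) (fromℕ-nonNegative n) refl) (≤-reflexive 1+n≈0)))

  ⁻¹-nonNegative : ∀ {x} → 0# ≤ x → ¬ (x ≈ 0#) → 0# ≤ x ⁻¹
  ⁻¹-nonNegative {x} 0≤x x≉0 = begin
    0#                ≤⟨ *-nonNegative 0≤x (square-nonNegative (x ⁻¹)) ⟩
    x * (x ⁻¹ * x ⁻¹) ≈⟨ *-assoc _ _ _ ⟨
    x * x ⁻¹ * x ⁻¹   ≈⟨ *-congʳ (⁻¹-inverseʳ x x≉0) ⟩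
    1# * x ⁻¹         ≈⟨ *-identityˡ _ ⟩
    x ⁻¹              ∎
    where open ≤-Reasoning

  *-cancelˡ-≤ : ∀ {x y z} → 0# ≤ z → ¬ (z ≈ 0#) → z * x ≤ z * y → x ≤ y
  *-cancelˡ-≤ {x} {y} {z} 0≤z z≉0 zx≤zy = begin
    x              ≈⟨ cancel x ⟨
    z ⁻¹ * (z * x) ≤⟨ *-monoʳ-≤ (⁻¹-nonNegative 0≤z z≉0) zx≤zy ⟩
    z ⁻¹ * (z * y) ≈⟨ cancel y ⟩
    y              ∎
    where
    open ≤-Reasoning
    cancel : ∀ x → z ⁻¹ * (z * x) ≈ x
    cancel x = trans (sym (*-assoc _ _ _)) (trans (*-congʳ (trans (*-comm _ _) (⁻¹-inverseʳ z z≉0))) (*-identityˡ x))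

  *-cancelˡ-fromℕ : ∀ n .{{_ : ℕ.NonZero n}} {x y} → fromℕ n * x ≤ fromℕ n * y → x ≤ y
  *-cancelˡ-fromℕ n = *-cancelˡ-≤ (fromℕ-nonNegative n) (fromℕ≉0 n)

  fromℕ-*-/ : ∀ m n .{{_ : ℕ.NonZero n}} → fromℕ n * (m / n) ≈ fromℕ m
  fromℕ-*-/ m n = begin
    fromℕ n * (fromℕ m * fromℕ n ⁻¹) ≈⟨ *-congˡ (*-comm _ _) ⟩
    fromℕ n * (fromℕ n ⁻¹ * fromℕ m) ≈⟨ *-assoc _ _ _ ⟨
    fromℕ n * fromℕ n ⁻¹ * fromℕ m   ≈⟨ *-congʳ (⁻¹-inverseʳ _ (fromℕ≉0 n)) ⟩
    1# * fromℕ m                     ≈⟨ *-identityˡ _ ⟩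
    fromℕ m                          ∎
    where open ≈-Reasoning

  ^-nonNegative : ∀ {x} → 0# ≤ x → ∀ n → 0# ≤ x ^ n
  ^-nonNegative 0≤x zero    = 0≤1
  ^-nonNegative 0≤x (suc n) = *-nonNegative 0≤x (^-nonNegative 0≤x n)

  ^≤1 : ∀ {x} → 0# ≤ x → x ≤ 1# → ∀ n → x ^ n ≤ 1#
  ^≤1 0≤x x≤1 zero    = ≤-refl
  ^≤1 0≤x x≤1 (suc n) = ≤-respʳ (*-identityˡ 1#) (*-mono-≤ 0≤x 0≤1 x≤1 (^≤1 0≤x x≤1 n))

  -- If `L` exceeded `B`, the choice ε = `L - B` would contradict convergence: a term that is at
  -- most `B` has distance at least ε from `L`.
  ⟶-eventually-≤ : ∀ {a L B} → a ⟶ L → ∀ N → (∀ n → N ℕ.≤ n → a n ≤ B) → L ≤ B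
  ⟶-eventually-≤ {a} {L} {B} a⟶L N aₙ≤B with L ≤? B
  ... | yes L≤B = L≤B
  ... | no  L≰B = contradiction (antisym (proj₁ close) far) (proj₂ close)
    where
    B≤L : B ≤ L
    B≤L with total L B
    ... | inj₁ L≤B = contradiction L≤B L≰B
    ... | inj₂ B≤L = B≤L
    ε≉0 : ¬ (0# ≈ L - B)
    ε≉0 0≈L-B = L≰B (0≤y-x⇒x≤y (≤-reflexive (begin
      0#        ≈⟨ -0#≈0# ⟨
      - 0#      ≈⟨ -‿cong 0≈L-B ⟩
      - (L - B) ≈⟨ solve 2 (λ L B → :- (L :- B) := B :- L) refl L B ⟩
      B - L     ∎)))
      where open ≈-Reasoning
    N′ : ∃[ N′ ] (∀ n → N′ ℕ.≤ n → abs (a n - L) < L - B)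
    N′ = a⟶L (L - B) (x≤y⇒0≤y-x B≤L , ε≉0)
    n : ℕ
    n = N ℕ.+ proj₁ N′
    close : abs (a n - L) < L - B
    close = proj₂ N′ n (ℕ.m≤n+m _ N)
    far : L - B ≤ abs (a n - L)
    far = begin
      L - B         ≤⟨ ≤-by (B - a n) (x≤y⇒0≤y-x (aₙ≤B n (ℕ.m≤m+n N _)))
                         (solve 3 (λ L B a → :- (a :- L) := (L :- B) :+ (B :- a)) refl L B (a n)) ⟩
      - (a n - L)   ≤⟨ Max.x≤y⊔x totalOrder _ _ ⟩
      abs (a n - L) ∎
      where open ≤-Reasoning

  -- Sums over permutations

  ∑-cong : ∀ {a} {A : Set a} (xs : List A) {f g} → (∀ x → f x ≈ g x) → ∑ xs f ≈ ∑ xs g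
  ∑-cong []       f≈g = refl
  ∑-cong (x ∷ xs) f≈g = +-cong (f≈g x) (∑-cong xs f≈g)

  ∑-+ : ∀ {a} {A : Set a} (xs : List A) f g → ∑ xs (λ x → f x + g x) ≈ ∑ xs f + ∑ xs g
  ∑-+ []       f g = sym (+-identityʳ 0#)
  ∑-+ (x ∷ xs) f g = trans (+-congˡ (∑-+ xs f g))
    (solve 4 (λ a b c d → (a :+ b) :+ (c :+ d) := (a :+ c) :+ (b :+ d)) refl (f x) (g x) (∑ xs f) (∑ xs g))

  *-∑ : ∀ {a} {A : Set a} (xs : List A) z f → ∑ xs (λ x → z * f x) ≈ z * ∑ xs f
  *-∑ []       z f = sym (zeroʳ z)
  *-∑ (x ∷ xs) z f = trans (+-congˡ (*-∑ xs z f)) (sym (distribˡ z _ _))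

  ∑-++ : ∀ {a} {A : Set a} (xs ys : List A) f → ∑ (xs ++ ys) f ≈ ∑ xs f + ∑ ys f
  ∑-++ []       ys f = sym (+-identityˡ _)
  ∑-++ (x ∷ xs) ys f = trans (+-congˡ (∑-++ xs ys f)) (sym (+-assoc _ _ _))

  ∑-map : ∀ {a b} {A : Set a} {B : Set b} (xs : List A) (g : A → B) f → ∑ (map g xs) f ≈ ∑ xs (f ∘ g)
  ∑-map []       g f = refl
  ∑-map (x ∷ xs) g f = +-congˡ (∑-map xs g f)

  ∑-product : ∀ {a} {A B C : Set a} (_⊗_ : A → B → C) xs ys f →
              ∑ (cartesianProductWith _⊗_ xs ys) f ≈ ∑ xs λ x → ∑ ys λ y → f (x ⊗ y)
  ∑-product _⊗_ []       ys f = refl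
  ∑-product _⊗_ (x ∷ xs) ys f = trans (∑-++ (map (x ⊗_) ys) _ f)
    (+-cong (∑-map ys (x ⊗_) f) (∑-product _⊗_ xs ys f))

  ∑-allFin-suc : ∀ k (f : Fin (suc k) → Carrier) → ∑ (allFin (suc k)) f ≈ f 0F + ∑ (allFin k) (f ∘ Fin.suc)
  ∑-allFin-suc k f = reflexive (≡.cong (λ ys → f 0F + foldr _+_ 0# ys)
    (≡.trans (map-tabulate Fin.suc f) (≡.sym (map-tabulate id (f ∘ Fin.suc)))))

  ∑-allFin-const : ∀ k z → ∑ (allFin k) (λ _ → z) ≈ fromℕ k * z
  ∑-allFin-const zero    z = sym (zeroˡ z)
  ∑-allFin-const (suc k) z = trans (∑-allFin-suc k (λ _ → z)) (trans (+-congˡ (∑-allFin-const k z))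
    (sym (trans (distribʳ z 1# (fromℕ k)) (+-congʳ (*-identityˡ z)))))

  ∏-cong : ∀ {a} {A : Set a} (xs : List A) {f g} → (∀ x → f x ≈ g x) → ∏ xs f ≈ ∏ xs g
  ∏-cong []       f≈g = refl
  ∏-cong (x ∷ xs) f≈g = *-cong (f≈g x) (∏-cong xs f≈g)

  ∏-allFin-suc : ∀ k (f : Fin (suc k) → Carrier) → ∏ (allFin (suc k)) f ≈ f 0F * ∏ (allFin k) (f ∘ Fin.suc)
  ∏-allFin-suc k f = reflexive (≡.cong (λ ys → f 0F * foldr _*_ 1# ys)
    (≡.trans (map-tabulate Fin.suc f) (≡.sym (map-tabulate id (f ∘ Fin.suc)))))

  -- Turns a product over a filtered list into one over all of `allFin k`, so that the index set no
  -- longer depends on the permutation.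
  infixl 9 [_]_
  [_]_ : Bool → Carrier → Carrier
  [ b ] z = if b then z else 1#

  []-cong : ∀ b {x y} → x ≈ y → [ b ] x ≈ [ b ] y
  []-cong true  x≈y = x≈y
  []-cong false x≈y = refl

  ∏-filter : ∀ {a p} {A : Set a} {P : A → Set p} (P? : Decidable P) (xs : List A) f →
             ∏ (filter P? xs) f ≈ ∏ xs λ x → [ does (P? x) ] f x
  ∏-filter P? []       f = refl
  ∏-filter P? (x ∷ xs) f with does (P? x)
  ... | true  = *-congˡ (∏-filter P? xs f)
  ... | false = trans (∏-filter P? xs f) (sym (*-identityˡ _))

  -- The cut-off `j` is a fixed number, not the position of a coordinate; this is what allows
  -- induction on `k`.
  prefix : ∀ {k} → (Fin k → Carrier) → ℕ → Permutation′ k → Carrier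
  prefix {k} w j σ = ∏ (allFin k) λ i → [ toℕ (σ ⟨$⟩ʳ i) <ᵇ j ] w i

  -- If coordinate `0F` sits at `l < j`, it occupies one of the first `j` positions and leaves
  -- `j - 1` to the others; otherwise the others fill all `j`. The count for `k` is an argument so
  -- that the lemma serves both as the induction step for constant weights and, afterwards, for one
  -- exceptional weight `w 0F`.
  ∑-prefix-insert : ∀ {k} {w : Fin (suc k) → Carrier} {q j} → (∀ i → w (Fin.suc i) ≈ q) →
    (∀ j → j ℕ.≤ k → ∑ (permutations k) (prefix (λ _ → q) j) ≈ fromℕ (k !) * q ^ j) →
    ∀ l → j ℕ.≤ suc k → ∑ (permutations k) (λ ρ → prefix w j (Perm.insert 0F l ρ)) ≈
    fromℕ (k !) * (if toℕ l <ᵇ j then w 0F * q ^ pred j else q ^ j)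
  ∑-prefix-insert {k} {w} {q} {j} w≈q ih l j≤1+k = begin
    ∑ (permutations k) (λ ρ → prefix w j (Perm.insert 0F l ρ))
      ≈⟨ ∑-cong (permutations k) (λ ρ → trans
           (∏-allFin-suc k (λ i → [ toℕ (Perm.insert 0F l ρ ⟨$⟩ʳ i) <ᵇ j ] w i))
           (*-congˡ (∏-cong (allFin k) λ i → []-cong (toℕ (punchIn l (ρ ⟨$⟩ʳ i)) <ᵇ j) (w≈q i)))) ⟩
    ∑ (permutations k) (λ ρ → [ toℕ l <ᵇ j ] w 0F * shifted ρ)
      ≈⟨ *-∑ (permutations k) _ shifted ⟩
    [ toℕ l <ᵇ j ] w 0F * ∑ (permutations k) shifted
      ≈⟨ cases ⟩
    fromℕ (k !) * (if toℕ l <ᵇ j then w 0F * q ^ pred j else q ^ j)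
      ∎
    where
    open ≈-Reasoning
    shifted : Permutation′ k → Carrier
    shifted ρ = ∏ (allFin k) λ i → [ toℕ (punchIn l (ρ ⟨$⟩ʳ i)) <ᵇ j ] q
    cases : [ toℕ l <ᵇ j ] w 0F * ∑ (permutations k) shifted ≈
            fromℕ (k !) * (if toℕ l <ᵇ j then w 0F * q ^ pred j else q ^ j)
    cases with toℕ l ℕ.<? j
    cases | yes l<j rewrite <⇒<ᵇ-true l<j with s≤s {n = j-1} l≤j-1 ← l<j = begin
      w 0F * ∑ (permutations k) shifted
        ≈⟨ *-congˡ (∑-cong (permutations k) λ ρ → ∏-cong (allFin k) λ i →
             reflexive (≡.cong ([_] q) (punchIn-<ᵇ-below l (ρ ⟨$⟩ʳ i) l≤j-1))) ⟩
      w 0F * ∑ (permutations k) (prefix (λ _ → q) j-1)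
        ≈⟨ *-congˡ (ih j-1 (ℕ.≤-pred j≤1+k)) ⟩
      w 0F * (fromℕ (k !) * q ^ j-1)
        ≈⟨ solve 3 (λ a b c → a :* (b :* c) := b :* (a :* c)) refl _ _ _ ⟩
      fromℕ (k !) * (w 0F * q ^ j-1) ∎
    cases | no l≮j rewrite ≥⇒<ᵇ-false (ℕ.≮⇒≥ l≮j) = begin
      1# * ∑ (permutations k) shifted
        ≈⟨ *-identityˡ _ ⟩
      ∑ (permutations k) shifted
        ≈⟨ ∑-cong (permutations k) (λ ρ → ∏-cong (allFin k) λ i →
             reflexive (≡.cong ([_] q) (punchIn-<ᵇ-above l (ρ ⟨$⟩ʳ i) (ℕ.≮⇒≥ l≮j)))) ⟩
      ∑ (permutations k) (prefix (λ _ → q) j)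
        ≈⟨ ih j (ℕ.≤-trans (ℕ.≮⇒≥ l≮j) (ℕ.≤-pred (Fin.toℕ<n l))) ⟩
      fromℕ (k !) * q ^ j ∎

  -- Every permutation sends exactly `j` coordinates to the first `j` positions, so all `k !`
  -- products equal `q ^ j`.
  ∑-prefix-const : ∀ k q j → j ℕ.≤ k → ∑ (permutations k) (prefix (λ _ → q) j) ≈ fromℕ (k !) * q ^ j
  ∑-prefix-const zero    q zero z≤n = begin
    1# + 0#          ≈⟨ *-identityʳ _ ⟨
    (1# + 0#) * 1#   ∎
    where open ≈-Reasoning
  ∑-prefix-const (suc k) q j j≤1+k = begin
    ∑ (permutations (suc k)) (prefix (λ _ → q) j)
      ≈⟨ ∑-product (Perm.insert 0F) (allFin (suc k)) (permutations k) _ ⟩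
    ∑ (allFin (suc k)) (λ l → ∑ (permutations k) λ ρ → prefix (λ _ → q) j (Perm.insert 0F l ρ))
      ≈⟨ ∑-cong (allFin (suc k)) (λ l → trans (∑-prefix-insert {w = λ _ → q} (λ _ → refl) (∑-prefix-const k q) l j≤1+k)
           (*-congˡ (branches (toℕ l) j))) ⟩
    ∑ (allFin (suc k)) (λ _ → fromℕ (k !) * q ^ j)
      ≈⟨ ∑-allFin-const (suc k) _ ⟩
    fromℕ (suc k) * (fromℕ (k !) * q ^ j)
      ≈⟨ *-assoc _ _ _ ⟨
    fromℕ (suc k) * fromℕ (k !) * q ^ j
      ≈⟨ *-congʳ (fromℕ-* (suc k) (k !)) ⟨
    fromℕ (suc k !) * q ^ j ∎
    where
    open ≈-Reasoning
    -- For `j = 0` the test fails, so `pred 0` never enters.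
    branches : ∀ l j → (if l <ᵇ j then q * q ^ pred j else q ^ j) ≈ q ^ j
    branches l       zero    = refl
    branches l       (suc j) with l <ᵇ suc j
    ... | true  = refl
    ... | false = refl

  S : ℕ → (ℕ → Carrier) → Carrier
  S zero    f = 0#
  S (suc n) f = S n f + f n

  S-cong : ∀ n {f g} → (∀ j → j ℕ.< n → f j ≈ g j) → S n f ≈ S n g
  S-cong zero    f≈g = refl
  S-cong (suc n) f≈g = +-cong (S-cong n (λ j j<n → f≈g j (ℕ.m<n⇒m<1+n j<n))) (f≈g n ℕ.≤-refl)

  S-head : ∀ n f → S (suc n) f ≈ f 0 + S n (f ∘ suc)
  S-head zero    f = +-comm _ _
  S-head (suc n) f = trans (+-congʳ (S-head n f)) (+-assoc _ _ _)

  S-+ : ∀ n f g → S n (λ j → f j + g j) ≈ S n f + S n g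
  S-+ zero    f g = sym (+-identityʳ 0#)
  S-+ (suc n) f g = trans (+-congʳ (S-+ n f g))
    (solve 4 (λ a b c d → (a :+ b) :+ (c :+ d) := (a :+ c) :+ (b :+ d)) refl _ _ _ _)

  S-* : ∀ n z f → S n (λ j → z * f j) ≈ z * S n f
  S-* zero    z f = sym (zeroʳ z)
  S-* (suc n) z f = trans (+-congʳ (S-* n z f)) (sym (distribˡ z _ _))

  ∑-allFin : ∀ n f → ∑ (allFin n) (f ∘ toℕ) ≈ S n f
  ∑-allFin zero    f = refl
  ∑-allFin (suc n) f = trans (∑-allFin-suc n (f ∘ toℕ)) (trans (+-congˡ (∑-allFin n (f ∘ suc))) (sym (S-head n f)))

  S-const : ∀ n z → S n (λ _ → z) ≈ fromℕ n * z
  S-const n z = trans (sym (∑-allFin n (λ _ → z))) (∑-allFin-const n z)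

  S-threshold : ∀ n {j} x y → j ℕ.≤ n → S n (λ l → if l <ᵇ j then x else y) ≈ fromℕ j * x + (fromℕ n - fromℕ j) * y
  S-threshold n       {zero}  x y _       = trans (S-const n y)
    (solve 3 (λ n x y → n :* y := con (+ 0) :* x :+ (n :- con (+ 0)) :* y) refl (fromℕ n) x y)
  S-threshold (suc n) {suc j} x y (s≤s p) = trans (S-head n _) (trans (+-congˡ (S-threshold n x y p))
    (solve 4 (λ n j x y → x :+ (j :* x :+ (n :- j) :* y) := (:1 :+ j) :* x :+ ((:1 :+ n) :- (:1 :+ j)) :* y)
       refl (fromℕ n) (fromℕ j) x y))

  -- Coordinate `0F` is at position `l`. The strict comparison excludes it, and the positions below
  -- `l` are those that the insertion leaves in place.
  before-0 : ∀ {k} (w : Fin (suc k) → Carrier) l (ρ : Permutation′ k) →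
             ∏ (before (Perm.insert 0F l ρ) 0F) w ≈ prefix (w ∘ Fin.suc) (toℕ l) ρ
  before-0 {k} w l ρ = begin
    ∏ (before σ 0F) w
      ≈⟨ ∏-filter (λ i → (σ ⟨$⟩ʳ i) Fin.<? (σ ⟨$⟩ʳ 0F)) (allFin (suc k)) w ⟩
    ∏ (allFin (suc k)) (λ i → [ toℕ (σ ⟨$⟩ʳ i) <ᵇ toℕ l ] w i)
      ≈⟨ ∏-allFin-suc k (λ i → [ toℕ (σ ⟨$⟩ʳ i) <ᵇ toℕ l ] w i) ⟩
    [ toℕ l <ᵇ toℕ l ] w 0F * ∏ (allFin k) (λ i → [ toℕ (punchIn l (ρ ⟨$⟩ʳ i)) <ᵇ toℕ l ] w (Fin.suc i))
      ≈⟨ *-cong (reflexive (≡.cong ([_] w 0F) (≥⇒<ᵇ-false {toℕ l} ℕ.≤-refl)))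
           (∏-cong (allFin k) λ i → reflexive (≡.cong ([_] w (Fin.suc i)) (punchIn-<ᵇ-above l (ρ ⟨$⟩ʳ i) ℕ.≤-refl))) ⟩
    1# * prefix (w ∘ Fin.suc) (toℕ l) ρ
      ≈⟨ *-identityˡ _ ⟩
    prefix (w ∘ Fin.suc) (toℕ l) ρ ∎
    where
    open ≈-Reasoning
    σ : Permutation′ (suc k)
    σ = Perm.insert 0F l ρ

  -- Inserting `0F` keeps the relative order of the other coordinates, so they contribute as if `1F`
  -- were at `l′`. The only new factor belongs to `0F`, which precedes `1F` exactly when `l ≤ l′`.
  before-1 : ∀ {k} (w : Fin (2 ℕ.+ k) → Carrier) l l′ (ρ : Permutation′ k) →
             ∏ (before (Perm.insert 0F l (Perm.insert 0F l′ ρ)) 1F) w ≈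
             [ toℕ l <ᵇ suc (toℕ l′) ] w 0F * prefix (w ∘ Fin.suc ∘ Fin.suc) (toℕ l′) ρ
  before-1 {k} w l l′ ρ = begin
    ∏ (before σ 1F) w
      ≈⟨ ∏-filter (λ i → (σ ⟨$⟩ʳ i) Fin.<? (σ ⟨$⟩ʳ 1F)) (allFin (2 ℕ.+ k)) w ⟩
    ∏ (allFin (2 ℕ.+ k)) (λ i → [ toℕ (σ ⟨$⟩ʳ i) <ᵇ toℕ (punchIn l l′) ] w i)
      ≈⟨ ∏-allFin-suc (suc k) (λ i → [ toℕ (σ ⟨$⟩ʳ i) <ᵇ toℕ (punchIn l l′) ] w i) ⟩
    [ toℕ l <ᵇ toℕ (punchIn l l′) ] w 0F *
      ∏ (allFin (suc k)) (λ i → [ toℕ (punchIn l (σ′ ⟨$⟩ʳ i)) <ᵇ toℕ (punchIn l l′) ] w (Fin.suc i))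
      ≈⟨ *-cong (reflexive (≡.cong ([_] w 0F) (<ᵇ-punchIn l l′)))
           (∏-cong (allFin (suc k)) λ i → reflexive (≡.cong ([_] w (Fin.suc i)) (punchIn-<ᵇ-punchIn l (σ′ ⟨$⟩ʳ i) l′))) ⟩
    [ toℕ l <ᵇ suc (toℕ l′) ] w 0F * ∏ (allFin (suc k)) (λ i → [ toℕ (σ′ ⟨$⟩ʳ i) <ᵇ toℕ l′ ] w (Fin.suc i))
      ≈⟨ *-congˡ (∏-filter (λ i → (σ′ ⟨$⟩ʳ i) Fin.<? l′) (allFin (suc k)) (w ∘ Fin.suc)) ⟨
    [ toℕ l <ᵇ suc (toℕ l′) ] w 0F * ∏ (before σ′ 0F) (w ∘ Fin.suc)
      ≈⟨ *-congˡ (before-0 (w ∘ Fin.suc) l′ ρ) ⟩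
    [ toℕ l <ᵇ suc (toℕ l′) ] w 0F * prefix (w ∘ Fin.suc ∘ Fin.suc) (toℕ l′) ρ ∎
    where
    open ≈-Reasoning
    σ′ : Permutation′ (suc k)
    σ′ = Perm.insert 0F l′ ρ
    σ : Permutation′ (2 ℕ.+ k)
    σ = Perm.insert 0F l σ′

  -- Let `j` of the `n` common coordinates precede the given one. The other special coordinate then
  -- has `n + 2` slots: `j + 1` before the given one, contributing `w`, and `n + 1 - j` after it,
  -- contributing 1.
  weight : Carrier → ℕ → ℕ → Carrier
  weight w n j = fromℕ (suc j) * w + (fromℕ (suc n) - fromℕ j)

  -- n ! * ahead w q n sums, over all orders of 2 + n coordinates, the product of the weights that
  -- precede a given coordinate, when one other coordinate has weight w and the remaining n have weight q.
  ahead : Carrier → Carrier → ℕ → Carrier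
  ahead w q n = S (suc n) λ j → q ^ j * weight w n j

  ∑-before-0 : ∀ {n} (w : Fin (2 ℕ.+ n) → Carrier) {q} → (∀ i → w (Fin.suc (Fin.suc i)) ≈ q) →
               ∑ (permutations (2 ℕ.+ n)) (λ σ → ∏ (before σ 0F) w) ≈ fromℕ (n !) * ahead (w 1F) q n
  ∑-before-0 {n} w {q} w≈q = begin
    ∑ (permutations (2 ℕ.+ n)) (λ σ → ∏ (before σ 0F) w)
      ≈⟨ ∑-product (Perm.insert 0F) (allFin (2 ℕ.+ n)) (permutations (suc n)) _ ⟩
    ∑ (allFin (2 ℕ.+ n)) (λ l → ∑ (permutations (suc n)) λ σ → ∏ (before (Perm.insert 0F l σ) 0F) w)
      ≈⟨ ∑-cong (allFin (2 ℕ.+ n)) inner ⟩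
    ∑ (allFin (2 ℕ.+ n)) (λ l → fromℕ (n !) * term (toℕ l))
      ≈⟨ *-∑ (allFin (2 ℕ.+ n)) _ (term ∘ toℕ) ⟩
    fromℕ (n !) * ∑ (allFin (2 ℕ.+ n)) (term ∘ toℕ)
      ≈⟨ *-congˡ (∑-allFin (2 ℕ.+ n) term) ⟩
    fromℕ (n !) * S (2 ℕ.+ n) term
      ≈⟨ *-congˡ (S-+ (2 ℕ.+ n) (λ j → fromℕ j * (w 1F * q ^ pred j)) _) ⟩
    fromℕ (n !) * (S (2 ℕ.+ n) (λ j → fromℕ j * (w 1F * q ^ pred j)) + S (2 ℕ.+ n) (λ j → (fromℕ (suc n) - fromℕ j) * q ^ j))
      -- The terms with `w 1F` carry one power of `q` less. The first sum loses its vanishing term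
      -- at 0 and is reindexed; the second loses its vanishing term at `n + 1`. Both then run over
      -- the same powers.
      ≈⟨ *-congˡ (+-cong (trans (S-head (suc n) _) (trans (+-congʳ (zeroˡ _)) (+-identityˡ _)))
                         (trans (+-congˡ (trans (*-congʳ (-‿inverseʳ _)) (zeroˡ _))) (+-identityʳ _))) ⟩
    fromℕ (n !) * (S (suc n) (λ j → fromℕ (suc j) * (w 1F * q ^ j)) + S (suc n) (λ j → (fromℕ (suc n) - fromℕ j) * q ^ j))
      ≈⟨ *-congˡ (S-+ (suc n) (λ j → fromℕ (suc j) * (w 1F * q ^ j)) _) ⟨
    fromℕ (n !) * S (suc n) (λ j → fromℕ (suc j) * (w 1F * q ^ j) + (fromℕ (suc n) - fromℕ j) * q ^ j)
      ≈⟨ *-congˡ (S-cong (suc n) λ j _ →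
           solve 4 (λ j n w q → j :* (w :* q) :+ n :* q := q :* (j :* w :+ n)) refl
             (fromℕ (suc j)) (fromℕ (suc n) - fromℕ j) (w 1F) (q ^ j)) ⟩
    fromℕ (n !) * ahead (w 1F) q n ∎
    where
    open ≈-Reasoning
    term : ℕ → Carrier
    term j = fromℕ j * (w 1F * q ^ pred j) + (fromℕ (suc n) - fromℕ j) * q ^ j
    inner : ∀ l → ∑ (permutations (suc n)) (λ σ → ∏ (before (Perm.insert 0F l σ) 0F) w) ≈ fromℕ (n !) * term (toℕ l)
    inner l = begin
      ∑ (permutations (suc n)) (λ σ → ∏ (before (Perm.insert 0F l σ) 0F) w)
        ≈⟨ ∑-cong (permutations (suc n)) (before-0 w l) ⟩
      ∑ (permutations (suc n)) (prefix (w ∘ Fin.suc) (toℕ l))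
        ≈⟨ ∑-product (Perm.insert 0F) (allFin (suc n)) (permutations n) _ ⟩
      ∑ (allFin (suc n)) (λ l′ → ∑ (permutations n) λ ρ → prefix (w ∘ Fin.suc) (toℕ l) (Perm.insert 0F l′ ρ))
        ≈⟨ ∑-cong (allFin (suc n)) (λ l′ → ∑-prefix-insert w≈q (∑-prefix-const n q) l′ (ℕ.≤-pred (Fin.toℕ<n l))) ⟩
      ∑ (allFin (suc n)) (λ l′ → fromℕ (n !) * (if toℕ l′ <ᵇ toℕ l then w 1F * q ^ pred (toℕ l) else q ^ toℕ l))
        ≈⟨ *-∑ (allFin (suc n)) _ _ ⟩
      fromℕ (n !) * ∑ (allFin (suc n)) (λ l′ → if toℕ l′ <ᵇ toℕ l then w 1F * q ^ pred (toℕ l) else q ^ toℕ l)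
        ≈⟨ *-congˡ (trans (∑-allFin (suc n) (λ l′ → if l′ <ᵇ toℕ l then w 1F * q ^ pred (toℕ l) else q ^ toℕ l))
             (S-threshold (suc n) _ _ (ℕ.≤-pred (Fin.toℕ<n l)))) ⟩
      fromℕ (n !) * term (toℕ l) ∎

  ∑-comm : ∀ {a b} {A : Set a} {B : Set b} (xs : List A) (ys : List B) (f : A → B → Carrier) →
           ∑ xs (λ x → ∑ ys (f x)) ≈ ∑ ys λ y → ∑ xs λ x → f x y
  ∑-comm []       ys f = sym (zeros ys)
    where
    zeros : ∀ ys → ∑ ys (λ _ → 0#) ≈ 0#
    zeros []       = refl
    zeros (y ∷ ys) = trans (+-identityˡ _) (zeros ys)
  ∑-comm (x ∷ xs) ys f = trans (+-congˡ (∑-comm xs ys f)) (sym (∑-+ ys (f x) _))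

  -- The two coordinates play symmetric roles, but the list of permutations places `0F` first and
  -- hides this. Here the power of `q` depends on `l′` alone, so the sums are exchanged and the
  -- positions `l` with `l ≤ l′` are counted for each `l′`.
  ∑-before-1 : ∀ {n} (w : Fin (2 ℕ.+ n) → Carrier) {q} → (∀ i → w (Fin.suc (Fin.suc i)) ≈ q) →
               ∑ (permutations (2 ℕ.+ n)) (λ σ → ∏ (before σ 1F) w) ≈ fromℕ (n !) * ahead (w 0F) q n
  ∑-before-1 {n} w {q} w≈q = begin
    ∑ (permutations (2 ℕ.+ n)) (λ σ → ∏ (before σ 1F) w)
      ≈⟨ ∑-product (Perm.insert 0F) (allFin (2 ℕ.+ n)) (permutations (suc n)) _ ⟩
    ∑ (allFin (2 ℕ.+ n)) (λ l → ∑ (permutations (suc n)) λ σ → ∏ (before (Perm.insert 0F l σ) 1F) w)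
      ≈⟨ ∑-cong (allFin (2 ℕ.+ n)) (λ l → trans (∑-product (Perm.insert 0F) (allFin (suc n)) (permutations n) _)
           (∑-cong (allFin (suc n)) (inner l))) ⟩
    ∑ (allFin (2 ℕ.+ n)) (λ l → ∑ (allFin (suc n)) λ l′ → fromℕ (n !) * q ^ toℕ l′ * [ toℕ l <ᵇ suc (toℕ l′) ] w 0F)
      ≈⟨ ∑-comm (allFin (2 ℕ.+ n)) (allFin (suc n)) _ ⟩
    ∑ (allFin (suc n)) (λ l′ → ∑ (allFin (2 ℕ.+ n)) λ l → fromℕ (n !) * q ^ toℕ l′ * [ toℕ l <ᵇ suc (toℕ l′) ] w 0F)
      ≈⟨ ∑-cong (allFin (suc n)) outer ⟩
    ∑ (allFin (suc n)) (λ l′ → fromℕ (n !) * term (toℕ l′))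
      ≈⟨ *-∑ (allFin (suc n)) _ (term ∘ toℕ) ⟩
    fromℕ (n !) * ∑ (allFin (suc n)) (term ∘ toℕ)
      ≈⟨ *-congˡ (∑-allFin (suc n) term) ⟩
    fromℕ (n !) * ahead (w 0F) q n ∎
    where
    open ≈-Reasoning
    term : ℕ → Carrier
    term j = q ^ j * (fromℕ (suc j) * w 0F + (fromℕ (suc n) - fromℕ j))
    inner : ∀ l l′ → ∑ (permutations n) (λ ρ → ∏ (before (Perm.insert 0F l (Perm.insert 0F l′ ρ)) 1F) w) ≈
                     fromℕ (n !) * q ^ toℕ l′ * [ toℕ l <ᵇ suc (toℕ l′) ] w 0F
    inner l l′ = begin
      ∑ (permutations n) (λ ρ → ∏ (before (Perm.insert 0F l (Perm.insert 0F l′ ρ)) 1F) w)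
        ≈⟨ ∑-cong (permutations n) (λ ρ → trans (before-1 w l l′ ρ)
             (*-congˡ (∏-cong (allFin n) λ i → []-cong (toℕ (ρ ⟨$⟩ʳ i) <ᵇ toℕ l′) (w≈q i)))) ⟩
      ∑ (permutations n) (λ ρ → [ toℕ l <ᵇ suc (toℕ l′) ] w 0F * prefix (λ _ → q) (toℕ l′) ρ)
        ≈⟨ *-∑ (permutations n) _ (prefix (λ _ → q) (toℕ l′)) ⟩
      [ toℕ l <ᵇ suc (toℕ l′) ] w 0F * ∑ (permutations n) (prefix (λ _ → q) (toℕ l′))
        ≈⟨ *-congˡ (∑-prefix-const n q (toℕ l′) (ℕ.≤-pred (Fin.toℕ<n l′))) ⟩
      [ toℕ l <ᵇ suc (toℕ l′) ] w 0F * (fromℕ (n !) * q ^ toℕ l′)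
        ≈⟨ *-comm _ _ ⟩
      fromℕ (n !) * q ^ toℕ l′ * [ toℕ l <ᵇ suc (toℕ l′) ] w 0F ∎
    outer : ∀ l′ → ∑ (allFin (2 ℕ.+ n)) (λ l → fromℕ (n !) * q ^ toℕ l′ * [ toℕ l <ᵇ suc (toℕ l′) ] w 0F) ≈
                   fromℕ (n !) * term (toℕ l′)
    outer l′ = begin
      ∑ (allFin (2 ℕ.+ n)) (λ l → fromℕ (n !) * q ^ toℕ l′ * [ toℕ l <ᵇ suc (toℕ l′) ] w 0F)
        ≈⟨ *-∑ (allFin (2 ℕ.+ n)) _ _ ⟩
      fromℕ (n !) * q ^ toℕ l′ * ∑ (allFin (2 ℕ.+ n)) (λ l → [ toℕ l <ᵇ suc (toℕ l′) ] w 0F)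
        ≈⟨ *-congˡ (trans (∑-allFin (2 ℕ.+ n) (λ l → [ l <ᵇ suc (toℕ l′) ] w 0F))
             (S-threshold (2 ℕ.+ n) (w 0F) 1# (ℕ.m≤n⇒m≤1+n (Fin.toℕ<n l′)))) ⟩
      fromℕ (n !) * q ^ toℕ l′ * (fromℕ (suc (toℕ l′)) * w 0F + (fromℕ (2 ℕ.+ n) - fromℕ (suc (toℕ l′))) * 1#)
        ≈⟨ solve 5 (λ f q j n w → f :* q :* ((:1 :+ j) :* w :+ ((:1 :+ n) :- (:1 :+ j)) :* :1) :=
                                  f :* (q :* ((:1 :+ j) :* w :+ (n :- j)))) refl
             (fromℕ (n !)) (q ^ toℕ l′) (fromℕ (toℕ l′)) (fromℕ (suc n)) (w 0F) ⟩
      fromℕ (n !) * term (toℕ l′) ∎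

  -- The common coordinates equal `z` propositionally, so that `F` need not be shown to respect `≈`.
  d-formula : ∀ n (x : Fin (2 ℕ.+ n) → Carrier) {z} → (∀ i → x (Fin.suc (Fin.suc i)) ≡ z) →
    fromℕ (2 ℕ.+ n) * fromℕ (suc n) * d n x ≈
    F′ (x 0F) * ahead (1# - F (x 1F)) (1# - F z) n + F′ (x 1F) * ahead (1# - F (x 0F)) (1# - F z) n
  d-formula n x {z} x≡z = begin
    fromℕ (2 ℕ.+ n) * fromℕ (suc n) * (fromℕ ((2 ℕ.+ n) !) ⁻¹ * total-sum)
      ≈⟨ *-congˡ (*-congˡ sum-value) ⟩
    fromℕ (2 ℕ.+ n) * fromℕ (suc n) * (fromℕ ((2 ℕ.+ n) !) ⁻¹ * (fromℕ (n !) * value))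
      ≈⟨ solve 5 (λ a b c d e → a :* b :* (c :* (d :* e)) := (a :* (b :* d)) :* c :* e) refl
           (fromℕ (2 ℕ.+ n)) (fromℕ (suc n)) (fromℕ ((2 ℕ.+ n) !) ⁻¹) (fromℕ (n !)) value ⟩
    fromℕ (2 ℕ.+ n) * (fromℕ (suc n) * fromℕ (n !)) * fromℕ ((2 ℕ.+ n) !) ⁻¹ * value
      ≈⟨ *-congʳ (*-congʳ (trans (fromℕ-* (2 ℕ.+ n) (suc n !)) (*-congˡ (fromℕ-* (suc n) (n !))))) ⟨
    fromℕ ((2 ℕ.+ n) !) * fromℕ ((2 ℕ.+ n) !) ⁻¹ * value
      ≈⟨ *-congʳ (⁻¹-inverseʳ _ (fromℕ≉0 ((2 ℕ.+ n) !) {{(2 ℕ.+ n) ℕ.!≢0}})) ⟩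
    1# * value
      ≈⟨ *-identityˡ value ⟩
    value ∎
    where
    open ≈-Reasoning
    w : Fin (2 ℕ.+ n) → Carrier
    w i = 1# - F (x i)
    q : Carrier
    q = 1# - F z
    w≈q : ∀ i → w (Fin.suc (Fin.suc i)) ≈ q
    w≈q i = reflexive (≡.cong (λ t → 1# - F t) (x≡z i))
    value total-sum : Carrier
    value = F′ (x 0F) * ahead (w 1F) q n + F′ (x 1F) * ahead (w 0F) q n
    total-sum = ∑ (permutations (2 ℕ.+ n)) λ σ → F′ (x 0F) * ∏ (before σ 0F) w + F′ (x 1F) * ∏ (before σ 1F) w
    sum-value : total-sum ≈ fromℕ (n !) * value
    sum-value = begin
      total-sum
        ≈⟨ ∑-+ (permutations (2 ℕ.+ n)) (λ σ → F′ (x 0F) * ∏ (before σ 0F) w) _ ⟩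
      ∑ (permutations (2 ℕ.+ n)) (λ σ → F′ (x 0F) * ∏ (before σ 0F) w) +
      ∑ (permutations (2 ℕ.+ n)) (λ σ → F′ (x 1F) * ∏ (before σ 1F) w)
        ≈⟨ +-cong (*-∑ (permutations (2 ℕ.+ n)) _ _) (*-∑ (permutations (2 ℕ.+ n)) _ _) ⟩
      F′ (x 0F) * ∑ (permutations (2 ℕ.+ n)) (λ σ → ∏ (before σ 0F) w) +
      F′ (x 1F) * ∑ (permutations (2 ℕ.+ n)) (λ σ → ∏ (before σ 1F) w)
        ≈⟨ +-cong (*-congˡ (∑-before-0 w w≈q)) (*-congˡ (∑-before-1 w w≈q)) ⟩
      F′ (x 0F) * (fromℕ (n !) * ahead (w 1F) q n) + F′ (x 1F) * (fromℕ (n !) * ahead (w 0F) q n)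
        ≈⟨ solve 5 (λ a b c d e → a :* (c :* d) :+ b :* (c :* e) := c :* (a :* d :+ b :* e)) refl
             (F′ (x 0F)) (F′ (x 1F)) (fromℕ (n !)) (ahead (w 1F) q n) (ahead (w 0F) q n) ⟩
      fromℕ (n !) * value ∎

  -- Binomial sums and Bonferroni inequalities

  S-mono-≤ : ∀ n {f g} → (∀ j → j ℕ.< n → f j ≤ g j) → S n f ≤ S n g
  S-mono-≤ zero    f≤g = ≤-refl
  S-mono-≤ (suc n) f≤g = +-mono-≤ (S-mono-≤ n (λ j j<n → f≤g j (ℕ.m<n⇒m<1+n j<n))) (f≤g n ℕ.≤-refl)

  S-comm : ∀ m n (f : ℕ → ℕ → Carrier) → S m (λ i → S n (f i)) ≈ S n (λ j → S m (λ i → f i j))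
  S-comm zero    n f = sym (trans (S-const n 0#) (zeroʳ _))
  S-comm (suc m) n f = trans (+-congʳ (S-comm m n f)) (sym (S-+ n _ (f m)))

  -- Field-valued, so that factors such as `n - i` may be negative and the identities hold without a
  -- condition `i ≤ n`.
  binomial : ℕ → ℕ → Carrier
  binomial n       zero    = 1#
  binomial zero    (suc i) = 0#
  binomial (suc n) (suc i) = binomial n i + binomial n (suc i)

  binomial-absorb : ∀ n i → fromℕ (suc i) * binomial (suc n) (suc i) ≈ fromℕ (suc n) * binomial n i
  binomial-absorb zero    zero    = solve 0 ((:1 :+ con (+ 0)) :* (:1 :+ con (+ 0)) := (:1 :+ con (+ 0)) :* :1) refl
  binomial-absorb zero    (suc i) = solve 1 (λ i → i :* (con (+ 0) :+ con (+ 0)) := (:1 :+ con (+ 0)) :* con (+ 0)) refl (fromℕ (2 ℕ.+ i))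
  binomial-absorb (suc n) zero    = begin
    fromℕ 1 * (1# + binomial (suc n) 1)        ≈⟨ solve 1 (λ b → con (+ 1) :* (:1 :+ b) := :1 :+ con (+ 1) :* b) refl _ ⟩
    1# + fromℕ 1 * binomial (suc n) 1          ≈⟨ +-congˡ (binomial-absorb n 0) ⟩
    1# + fromℕ (suc n) * 1#                    ≈⟨ solve 1 (λ n → :1 :+ n :* :1 := (:1 :+ n) :* :1) refl (fromℕ (suc n)) ⟩
    fromℕ (2 ℕ.+ n) * 1#                       ∎
    where open ≈-Reasoning
  binomial-absorb (suc n) (suc i) = begin
    fromℕ (2 ℕ.+ i) * (b₁ + b₂)
      ≈⟨ solve 3 (λ i b₁ b₂ → (:1 :+ i) :* (b₁ :+ b₂) := b₁ :+ i :* b₁ :+ (:1 :+ i) :* b₂) refl (fromℕ (suc i)) b₁ b₂ ⟩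
    b₁ + fromℕ (suc i) * b₁ + fromℕ (2 ℕ.+ i) * b₂
      ≈⟨ +-cong (+-congˡ (binomial-absorb n i)) (binomial-absorb n (suc i)) ⟩
    b₁ + fromℕ (suc n) * binomial n i + fromℕ (suc n) * binomial n (suc i)
      ≈⟨ solve 3 (λ n b₁ b₂ → b₁ :+ b₂ :+ n :* b₁ :+ n :* b₂ := (:1 :+ n) :* (b₁ :+ b₂)) refl
           (fromℕ (suc n)) (binomial n i) (binomial n (suc i)) ⟩
    fromℕ (2 ℕ.+ n) * b₁ ∎
    where
    open ≈-Reasoning
    b₁ b₂ : Carrier
    b₁ = binomial (suc n) (suc i)
    b₂ = binomial (suc n) (2 ℕ.+ i)

  binomial-step : ∀ n i → fromℕ (suc i) * binomial n (suc i) ≈ (fromℕ n - fromℕ i) * binomial n i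
  binomial-step n i = begin
    fromℕ (suc i) * b₁
      ≈⟨ solve 3 (λ i b₀ b₁ → (:1 :+ i) :* b₁ := (:1 :+ i) :* (b₀ :+ b₁) :- (:1 :+ i) :* b₀) refl (fromℕ i) b₀ b₁ ⟩
    fromℕ (suc i) * (b₀ + b₁) - fromℕ (suc i) * b₀
      ≈⟨ +-congʳ (binomial-absorb n i) ⟩
    fromℕ (suc n) * b₀ - fromℕ (suc i) * b₀
      ≈⟨ solve 3 (λ n i b₀ → (:1 :+ n) :* b₀ :- (:1 :+ i) :* b₀ := (n :- i) :* b₀) refl (fromℕ n) (fromℕ i) b₀ ⟩
    (fromℕ n - fromℕ i) * b₀ ∎
    where
    open ≈-Reasoning
    b₀ b₁ : Carrier
    b₀ = binomial n i
    b₁ = binomial n (suc i)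

  2*binomial : ∀ n → fromℕ 2 * binomial (2 ℕ.+ n) 2 ≈ fromℕ (2 ℕ.+ n) * fromℕ (suc n)
  2*binomial n = begin
    fromℕ 2 * binomial (2 ℕ.+ n) 2                   ≈⟨ binomial-absorb (suc n) 1 ⟩
    fromℕ (2 ℕ.+ n) * binomial (suc n) 1             ≈⟨ *-congˡ (solve 1 (λ b → b := con (+ 1) :* b) refl _) ⟩
    fromℕ (2 ℕ.+ n) * (fromℕ 1 * binomial (suc n) 1) ≈⟨ *-congˡ (binomial-absorb n 0) ⟩
    fromℕ (2 ℕ.+ n) * (fromℕ (suc n) * 1#)           ≈⟨ *-congˡ (*-identityʳ _) ⟩
    fromℕ (2 ℕ.+ n) * fromℕ (suc n)                  ∎
    where open ≈-Reasoning

  hockey-stick : ∀ n i → S n (λ j → binomial j i) ≈ binomial n (suc i)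
  hockey-stick zero    i = refl
  hockey-stick (suc n) i = trans (+-congʳ (hockey-stick n i)) (+-comm _ _)

  -- By absorption, `(j + 1) binomial j i` is `(i + 1) binomial (j + 1) (i + 1)`: this is the
  -- hockey-stick identity one row and one column further.
  hockey-stick-rising : ∀ n i → S n (λ j → fromℕ (suc j) * binomial j i) ≈ fromℕ (suc i) * binomial (suc n) (2 ℕ.+ i)
  hockey-stick-rising zero    i = solve 1 (λ i → con (+ 0) := i :* (con (+ 0) :+ con (+ 0))) refl (fromℕ (suc i))
  hockey-stick-rising (suc n) i = begin
    S n (λ j → fromℕ (suc j) * binomial j i) + fromℕ (suc n) * binomial n i
      ≈⟨ +-cong (hockey-stick-rising n i) (sym (binomial-absorb n i)) ⟩
    fromℕ (suc i) * binomial (suc n) (2 ℕ.+ i) + fromℕ (suc i) * binomial (suc n) (suc i)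
      ≈⟨ trans (sym (distribˡ _ _ _)) (*-congˡ (+-comm _ _)) ⟩
    fromℕ (suc i) * binomial (2 ℕ.+ n) (2 ℕ.+ i) ∎
    where open ≈-Reasoning

  -- Raising `n` by one adds a plain hockey-stick sum, so this is a sum of such sums.
  hockey-stick-falling : ∀ n i → S n (λ j → (fromℕ n - fromℕ j) * binomial j i) ≈ binomial (suc n) (2 ℕ.+ i)
  hockey-stick-falling zero    i = sym (+-identityʳ 0#)
  hockey-stick-falling (suc n) i = begin
    S n (λ j → (fromℕ (suc n) - fromℕ j) * binomial j i) + (fromℕ (suc n) - fromℕ n) * binomial n i
      ≈⟨ +-cong
           (trans (S-cong n λ j _ → solve 3 (λ n j b → ((:1 :+ n) :- j) :* b := (n :- j) :* b :+ b) refl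
                    (fromℕ n) (fromℕ j) (binomial j i))
                  (S-+ n (λ j → (fromℕ n - fromℕ j) * binomial j i) _))
           (solve 2 (λ n b → ((:1 :+ n) :- n) :* b := b) refl (fromℕ n) (binomial n i)) ⟩
    S n (λ j → (fromℕ n - fromℕ j) * binomial j i) + S n (λ j → binomial j i) + binomial n i
      ≈⟨ +-assoc _ _ _ ⟩
    S n (λ j → (fromℕ n - fromℕ j) * binomial j i) + S (suc n) (λ j → binomial j i)
      ≈⟨ +-cong (hockey-stick-falling n i) (hockey-stick (suc n) i) ⟩
    binomial (suc n) (2 ℕ.+ i) + binomial (suc n) (suc i)
      ≈⟨ +-comm _ _ ⟩
    binomial (2 ℕ.+ n) (2 ℕ.+ i) ∎
    where open ≈-Reasoning

  -- The rising and the falling sum yield the same binomial coefficient, so `w` survives only in a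
  -- linear factor.
  S-binomial-weight : ∀ w n i → S (suc n) (λ j → binomial j i * weight w n j) ≈
                      (1# + fromℕ (suc i) * w) * binomial (2 ℕ.+ n) (2 ℕ.+ i)
  S-binomial-weight w n i = begin
    S (suc n) (λ j → binomial j i * weight w n j)
      ≈⟨ S-cong (suc n) (λ j _ → solve 4 (λ b j w f → b :* (j :* w :+ f) := w :* (j :* b) :+ f :* b) refl
           (binomial j i) (fromℕ (suc j)) w (fromℕ (suc n) - fromℕ j)) ⟩
    S (suc n) (λ j → w * (fromℕ (suc j) * binomial j i) + (fromℕ (suc n) - fromℕ j) * binomial j i)
      ≈⟨ S-+ (suc n) (λ j → w * (fromℕ (suc j) * binomial j i)) _ ⟩
    S (suc n) (λ j → w * (fromℕ (suc j) * binomial j i)) + S (suc n) (λ j → (fromℕ (suc n) - fromℕ j) * binomial j i)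
      ≈⟨ +-cong (trans (S-* (suc n) w _) (*-congˡ (hockey-stick-rising (suc n) i))) (hockey-stick-falling (suc n) i) ⟩
    w * (fromℕ (suc i) * b) + b
      ≈⟨ solve 3 (λ w i b → w :* (i :* b) :+ b := (:1 :+ i :* w) :* b) refl w (fromℕ (suc i)) b ⟩
    (1# + fromℕ (suc i) * w) * b ∎
    where
    open ≈-Reasoning
    b : Carrier
    b = binomial (2 ℕ.+ n) (2 ℕ.+ i)

  weight-nonNegative : ∀ {w} n {j} → 0# ≤ w → j ℕ.≤ n → 0# ≤ weight w n j
  weight-nonNegative n {j} 0≤w j≤n = +-nonNegative (*-nonNegative (fromℕ-nonNegative (suc j)) 0≤w)
    (x≤y⇒0≤y-x (fromℕ-mono-≤ (ℕ.m≤n⇒m≤1+n j≤n)))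

  -- `N` counts the terms kept from the binomial expansion of `(1 - h) ^ j`, so the last degree is
  -- `N - 1`.
  partial : Carrier → ℕ → ℕ → Carrier
  partial h N j = S N λ i → (- h) ^ i * binomial j i

  partial-zero : ∀ h N → partial h (suc N) 0 ≈ 1#
  partial-zero h zero    = solve 0 (con (+ 0) :+ :1 :* :1 := :1) refl
  partial-zero h (suc N) = trans (+-cong (partial-zero h N) (zeroʳ _)) (+-identityʳ 1#)

  partial-suc : ∀ h N j → partial h (suc N) (suc j) ≈ partial h (suc N) j - h * partial h N j
  partial-suc h zero    j = solve 1 (λ h → con (+ 0) :+ :1 :* :1 := (con (+ 0) :+ :1 :* :1) :- h :* con (+ 0)) refl h
  partial-suc h (suc N) j = begin
    partial h (suc N) (suc j) + (- h) ^ suc N * binomial (suc j) (suc N)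
      ≈⟨ +-congʳ (partial-suc h N j) ⟩
    (partial h (suc N) j - h * partial h N j) + (- h) ^ suc N * binomial (suc j) (suc N)
      ≈⟨ solve 6 (λ p p′ h e b b′ → (p :- h :* p′) :+ (:- h :* e) :* (b :+ b′) := (p :+ (:- h :* e) :* b′) :- h :* (p′ :+ e :* b))
           refl (partial h (suc N) j) (partial h N j) h ((- h) ^ N) (binomial j N) (binomial j (suc N)) ⟩
    partial h (2 ℕ.+ N) j - h * partial h (suc N) j ∎
    where open ≈-Reasoning

  -- By Pascal's rule, the remainder for `suc N` and `suc j` is the one for `suc N` and `j` minus
  -- `h` times the one for `N` and `j`. After multiplication by the alternating sign both
  -- contributions are nonnegative.
  bonferroni : ∀ {h} → 0# ≤ h → h ≤ 1# → ∀ N j → 0# ≤ (- 1#) ^ N * ((1# - h) ^ j - partial h N j)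
  bonferroni {h} 0≤h h≤1 zero    j    = ≤-respʳ
    (solve 1 (λ x → x := :1 :* (x :- con (+ 0))) refl ((1# - h) ^ j)) (^-nonNegative (x≤y⇒0≤y-x h≤1) j)
  bonferroni {h} 0≤h h≤1 (suc N) zero = ≤-reflexive (sym (begin
    (- 1#) ^ suc N * (1# - partial h (suc N) 0) ≈⟨ *-congˡ (+-congˡ (-‿cong (partial-zero h N))) ⟩
    (- 1#) ^ suc N * (1# - 1#)                  ≈⟨ *-congˡ (-‿inverseʳ 1#) ⟩
    (- 1#) ^ suc N * 0#                         ≈⟨ zeroʳ _ ⟩
    0#                                          ∎))
    where open ≈-Reasoning
  bonferroni {h} 0≤h h≤1 (suc N) (suc j) = begin
    0#
      ≤⟨ +-nonNegative (bonferroni 0≤h h≤1 (suc N) j) (*-nonNegative 0≤h (bonferroni 0≤h h≤1 N j)) ⟩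
    (- 1#) ^ suc N * (Q - partial h (suc N) j) + h * ((- 1#) ^ N * (Q - partial h N j))
      ≈⟨ solve 5 (λ e Q p p′ h → :- :1 :* e :* (Q :- p) :+ h :* (e :* (Q :- p′)) :=
                                 :- :1 :* e :* ((:1 :- h) :* Q :- (p :- h :* p′))) refl
           ((- 1#) ^ N) Q (partial h (suc N) j) (partial h N j) h ⟩
    (- 1#) ^ suc N * ((1# - h) * Q - (partial h (suc N) j - h * partial h N j))
      ≈⟨ *-congˡ (+-congˡ (-‿cong (partial-suc h N j))) ⟨
    (- 1#) ^ suc N * ((1# - h) ^ suc j - partial h (suc N) (suc j)) ∎
    where
    open ≤-Reasoning
    Q : Carrier
    Q = (1# - h) ^ j

  ahead-0-bound : ∀ {q} n → 0# ≤ q → q ≤ 1# → fromℕ 2 * ahead 0# q n ≤ fromℕ (2 ℕ.+ n) * fromℕ (suc n)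
  ahead-0-bound {q} n 0≤q q≤1 = begin
    fromℕ 2 * ahead 0# q n
      ≤⟨ *-monoʳ-≤ (fromℕ-nonNegative 2) (S-mono-≤ (suc n) λ j j≤n →
           *-monoˡ-≤ (weight-nonNegative n ≤-refl (ℕ.≤-pred j≤n)) (^≤1 0≤q q≤1 j)) ⟩
    fromℕ 2 * S (suc n) (λ j → 1# * weight 0# n j)
      ≈⟨ *-congˡ (S-binomial-weight 0# n 0) ⟩
    fromℕ 2 * ((1# + fromℕ 1 * 0#) * binomial (2 ℕ.+ n) 2)
      ≈⟨ solve 1 (λ b → con (+ 2) :* ((:1 :+ con (+ 1) :* con (+ 0)) :* b) := con (+ 2) :* b) refl _ ⟩
    fromℕ 2 * binomial (2 ℕ.+ n) 2
      ≈⟨ 2*binomial n ⟩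
    fromℕ (2 ℕ.+ n) * fromℕ (suc n) ∎
    where
    open ≤-Reasoning

  ahead-bound : ∀ {h w} n → 0# ≤ h → h ≤ 1# → 0# ≤ w →
    ahead w (1# - h) n ≤ S 7 λ i → (- h) ^ i * ((1# + fromℕ (suc i) * w) * binomial (2 ℕ.+ n) (2 ℕ.+ i))
  ahead-bound {h} {w} n 0≤h h≤1 0≤w = begin
    ahead w (1# - h) n
      ≤⟨ S-mono-≤ (suc n) (λ j j≤n → *-monoˡ-≤ (weight-nonNegative n 0≤w (ℕ.≤-pred j≤n)) (overestimate j)) ⟩
    S (suc n) (λ j → partial h 7 j * weight w n j)
      ≈⟨ S-cong (suc n) (λ j _ → trans (*-comm _ _) (sym (S-* 7 (weight w n j) (λ i → (- h) ^ i * binomial j i)))) ⟩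
    S (suc n) (λ j → S 7 λ i → weight w n j * ((- h) ^ i * binomial j i))
      ≈⟨ S-comm (suc n) 7 (λ j i → weight w n j * ((- h) ^ i * binomial j i)) ⟩
    S 7 (λ i → S (suc n) λ j → weight w n j * ((- h) ^ i * binomial j i))
      ≈⟨ S-cong 7 (λ i _ → trans
           (S-cong (suc n) λ j _ → solve 3 (λ a b c → a :* (b :* c) := b :* (c :* a)) refl (weight w n j) ((- h) ^ i) (binomial j i))
           (trans (S-* (suc n) ((- h) ^ i) _) (*-congˡ (S-binomial-weight w n i)))) ⟩
    S 7 (λ i → (- h) ^ i * ((1# + fromℕ (suc i) * w) * binomial (2 ℕ.+ n) (2 ℕ.+ i))) ∎
    where
    open ≤-Reasoning
    -- Seven terms: an odd number makes the remainder nonpositive, so the truncation lies above.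
    overestimate : ∀ j → (1# - h) ^ j ≤ partial h 7 j
    overestimate j = ≤-by _ (bonferroni 0≤h h≤1 7 j)
      (solve 2 (λ p Q → p := Q :+ (:- :1) :^ 7 :* (Q :- p)) refl (partial h 7 j) ((1# - h) ^ j))

  -- Falling powers against ordinary powers

  -- With `n h = y` this is the falling factorial `n (n - 1) ... (n - i + 1)` times `h ^ i`, written
  -- without `n`; at `h = 0` it is `y ^ i`.
  falling : Carrier → Carrier → ℕ → Carrier
  falling y h zero    = 1#
  falling y h (suc i) = (y - fromℕ i * h) * falling y h i

  binomial-falling : ∀ {y h} n → fromℕ n * h ≈ y → ∀ i →
    fromℕ ((2 ℕ.+ i) !) * (binomial (2 ℕ.+ n) (2 ℕ.+ i) * h ^ i) ≈ fromℕ (2 ℕ.+ n) * fromℕ (suc n) * falling y h i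
  binomial-falling {y} {h} n nh≈y zero = begin
    fromℕ 2 * (binomial (2 ℕ.+ n) 2 * 1#) ≈⟨ *-congˡ (*-identityʳ _) ⟩
    fromℕ 2 * binomial (2 ℕ.+ n) 2        ≈⟨ 2*binomial n ⟩
    fromℕ (2 ℕ.+ n) * fromℕ (suc n)       ≈⟨ *-identityʳ _ ⟨
    fromℕ (2 ℕ.+ n) * fromℕ (suc n) * 1#  ∎
    where open ≈-Reasoning
  binomial-falling {y} {h} n nh≈y (suc i) = begin
    fromℕ ((3 ℕ.+ i) !) * (b₁ * (h * h ^ i))
      ≈⟨ *-congʳ (fromℕ-* (3 ℕ.+ i) ((2 ℕ.+ i) !)) ⟩
    fromℕ (3 ℕ.+ i) * f * (b₁ * (h * h ^ i))
      ≈⟨ solve 5 (λ a f b h e → a :* f :* (b :* (h :* e)) := f :* (a :* b) :* h :* e) refl (fromℕ (3 ℕ.+ i)) f b₁ h (h ^ i) ⟩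
    f * (fromℕ (3 ℕ.+ i) * b₁) * h * h ^ i
      ≈⟨ *-congʳ (*-congʳ (*-congˡ (binomial-step (2 ℕ.+ n) (2 ℕ.+ i)))) ⟩
    f * ((fromℕ (2 ℕ.+ n) - fromℕ (2 ℕ.+ i)) * b₀) * h * h ^ i
      ≈⟨ solve 6 (λ f n i b h e → f :* (((:1 :+ (:1 :+ n)) :- (:1 :+ (:1 :+ i))) :* b) :* h :* e :=
                                  (n :* h :- i :* h) :* (f :* (b :* e))) refl f (fromℕ n) (fromℕ i) b₀ h (h ^ i) ⟩
    (fromℕ n * h - fromℕ i * h) * (f * (b₀ * h ^ i))
      ≈⟨ *-cong (+-congʳ nh≈y) (binomial-falling n nh≈y i) ⟩
    (y - fromℕ i * h) * (fromℕ (2 ℕ.+ n) * fromℕ (suc n) * falling y h i)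
      ≈⟨ solve 3 (λ a b c → a :* (b :* c) := b :* (a :* c)) refl
           (y - fromℕ i * h) (fromℕ (2 ℕ.+ n) * fromℕ (suc n)) (falling y h i) ⟩
    fromℕ (2 ℕ.+ n) * fromℕ (suc n) * falling y h (suc i) ∎
    where
    open ≈-Reasoning
    f b₀ b₁ : Carrier
    f  = fromℕ ((2 ℕ.+ i) !)
    b₀ = binomial (2 ℕ.+ n) (2 ℕ.+ i)
    b₁ = binomial (2 ℕ.+ n) (3 ℕ.+ i)

  -- The gap `y ^ i - falling y h i` grows to `y` times itself plus `i h` times `falling y h i`; the
  -- recursion inserts `y ≤ 2` and `falling y h i ≤ 2 ^ i`.
  slack : ℕ → ℕ
  slack zero    = 0
  slack (suc i) = 2 ℕ.* slack i ℕ.+ i ℕ.* 2 ℕ.^ i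

  -- The bounds share one induction because the last of them needs the others. The condition `i ≤ n`
  -- keeps every factor `y - j h` nonnegative.
  falling-bounds : ∀ {y h} n → fromℕ n * h ≈ y → 0# ≤ h → y ≤ fromℕ 2 → ∀ i → i ℕ.≤ n →
    0# ≤ falling y h i × falling y h i ≤ y ^ i × y ^ i ≤ fromℕ (2 ℕ.^ i) × y ^ i ≤ falling y h i + fromℕ (slack i) * h
  falling-bounds {y} {h} n nh≈y 0≤h y≤2 zero    _   = 0≤1 , ≤-refl , ≤-reflexive (sym (+-identityʳ 1#)) ,
    ≤-reflexive (solve 1 (λ h → :1 := :1 :+ con (+ 0) :* h) refl h)
  falling-bounds {y} {h} n nh≈y 0≤h y≤2 (suc i) i<n
    with 0≤σ , σ≤yⁱ , yⁱ≤2ⁱ , yⁱ≤σ ← falling-bounds n nh≈y 0≤h y≤2 i (ℕ.<⇒≤ i<n) =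
    *-nonNegative 0≤y-ih 0≤σ ,
    *-mono-≤ 0≤y-ih (≤-trans 0≤σ σ≤yⁱ) y-ih≤y σ≤yⁱ ,
    ≤-respʳ (sym (fromℕ-* 2 (2 ℕ.^ i))) (*-mono-≤ 0≤y (fromℕ-nonNegative (2 ℕ.^ i)) y≤2 yⁱ≤2ⁱ) ,
    (begin
      y * y ^ i
        ≤⟨ *-monoʳ-≤ 0≤y yⁱ≤σ ⟩
      y * (σ + K * h)
        ≈⟨ solve 5 (λ y σ K h i → y :* (σ :+ K :* h) := (y :- i :* h) :* σ :+ (y :* (K :* h) :+ i :* h :* σ)) refl y σ K h (fromℕ i) ⟩
      (y - fromℕ i * h) * σ + (y * (K * h) + fromℕ i * h * σ)
        ≤⟨ +-monoʳ-≤ _ (+-mono-≤ (*-monoˡ-≤ (*-nonNegative (fromℕ-nonNegative (slack i)) 0≤h) y≤2)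
             (*-monoʳ-≤ 0≤ih (≤-trans σ≤yⁱ yⁱ≤2ⁱ))) ⟩
      (y - fromℕ i * h) * σ + (fromℕ 2 * (K * h) + fromℕ i * h * fromℕ (2 ℕ.^ i))
        ≈⟨ +-congˡ (solve 5 (λ t K h i p → t :* (K :* h) :+ i :* h :* p := (t :* K :+ i :* p) :* h) refl (fromℕ 2) K h (fromℕ i) (fromℕ (2 ℕ.^ i))) ⟩
      (y - fromℕ i * h) * σ + (fromℕ 2 * K + fromℕ i * fromℕ (2 ℕ.^ i)) * h
        ≈⟨ +-congˡ (*-congʳ (trans (fromℕ-+ (2 ℕ.* slack i) (i ℕ.* 2 ℕ.^ i)) (+-cong (fromℕ-* 2 (slack i)) (fromℕ-* i (2 ℕ.^ i))))) ⟨
      (y - fromℕ i * h) * σ + fromℕ (slack (suc i)) * h ∎)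
    where
    open ≤-Reasoning
    σ K : Carrier
    σ = falling y h i
    K = fromℕ (slack i)
    0≤y : 0# ≤ y
    0≤y = ≤-respʳ nh≈y (*-nonNegative (fromℕ-nonNegative n) 0≤h)
    0≤ih : 0# ≤ fromℕ i * h
    0≤ih = *-nonNegative (fromℕ-nonNegative i) 0≤h
    0≤y-ih : 0# ≤ y - fromℕ i * h
    0≤y-ih = x≤y⇒0≤y-x (≤-respʳ nh≈y (*-monoˡ-≤ 0≤h (fromℕ-mono-≤ (ℕ.<⇒≤ i<n))))
    y-ih≤y : y - fromℕ i * h ≤ y
    y-ih≤y = ≤-by (fromℕ i * h) 0≤ih (solve 2 (λ y z → y := (y :- z) :+ z) refl y (fromℕ i * h))

  -- The limiting polynomial

  -- Compares normal forms rather than their values, so that large coefficients are never unfolded into sums of 1#.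
  prove-normal : ∀ {n} (ρ : Vec Carrier n) (p q : Polynomial n) → normalise p ≡ normalise q → ⟦ p ⟧ ρ ≈ ⟦ q ⟧ ρ
  prove-normal ρ p q eq = trans (sym (correct p ρ)) (trans (reflexive (≡.cong (λ r → ⟦ r ⟧N ρ) eq)) (correct q ρ))

  -- 36 a (2 + (i+1) (w₁ + w₂)) = 11 κ y i, where wⱼ = 1 - a xⱼ.
  κ : Carrier → ℕ → Carrier
  κ y i = fromℕ 12 + fromℕ (suc i) * (1# + fromℕ 6 * y)

  -- The truncated series scaled by `8 !`: `f` holds the powers of `y`, exact or falling, and `g`
  -- the linear factors that come from the weights.
  alternating : (ℕ → Carrier) → (ℕ → Carrier) → Carrier
  alternating f g = S 7 λ i → (- 1#) ^ i * (fromℕ (coefficient i) * f i * g i)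

  -- 687500 = 11 ∙ 62500 and 182718789120 = 36 ∙ 8 ! ∙ 125881, where 125881 / 62500 = 2.014096;
  -- the slack of 1000 is left for the discretisation error.
  taylor-bound : ∀ {y} → 0# ≤ y → y ≤ fromℕ 2 →
                 fromℕ 687500 * alternating (y ^_) (κ y) + fromℕ 1000 ≤ fromℕ 182718789120
  -- The multiplier is 2 ∙ 424⁷: evaluating a polynomial of degree 7 at 125/424 produces the
  -- denominator 424⁷, and the length of [0, 2] gives the 2.
  taylor-bound {y} 0≤y y≤2 = *-cancelˡ-fromℕ 4927095632662888448 (≤-by (⟦ certificate ⟧ (y ∷ [])) certificate≥0
    (prove-normal (y ∷ []) (♯ 4927095632662888448 :* ♯ 182718789120)
      (♯ 4927095632662888448 :* (♯ 687500 :* Taylor 7 :+ ♯ 1000) :+ certificate) ≡.refl))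
    where
    infix 9 ♯_
    ♯_ : ℕ → Polynomial 1
    ♯ n = con (+ n)
    Y Z bernstein certificate : Polynomial 1
    Y = var 0F
    Z = ♯ 2 :- Y
    Taylor : ℕ → Polynomial 1
    Taylor zero    = ♯ 0
    Taylor (suc i) = Taylor i :+ (:- :1) :^ i :* (♯ coefficient i :* Y :^ i :* (♯ 12 :+ ♯ suc i :* (:1 :+ ♯ 6 :* Y)))
    -- The Taylor polynomial has its maximum near 125/424; the quotient by the square of 424 y - 125
    -- has positive Bernstein coefficients on [0, 2].
    bernstein =
         ♯ 25016683152427486953125  :* Y :^ 0 :* Z :^ 5 :+ ♯ 100299874389099430890625 :* Y :^ 1 :* Z :^ 4
      :+ ♯ 165805374009145366031250 :* Y :^ 2 :* Z :^ 3 :+ ♯ 139243844206620910281250 :* Y :^ 3 :* Z :^ 2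
      :+ ♯ 59488620507693787265625  :* Y :^ 4 :* Z :^ 1 :+ ♯ 9975585995976763078125   :* Y :^ 5 :* Z :^ 0
    certificate = (♯ 424 :* Y :- ♯ 125) :* (♯ 424 :* Y :- ♯ 125) :* bernstein
               -- The remainder of the division is the tangent line at 125/424. It is not constant,
               -- as this point only approximates the maximiser; its coefficients along `Z` and `Y`
               -- are positive because it is positive at both ends of [0, 2].
               :+ (♯ 255141047340840052568880 :* Z :+ ♯ 2445730699034762568880 :* Y)
    0≤z : 0# ≤ fromℕ 2 - y
    0≤z = x≤y⇒0≤y-x y≤2
    term≥0 : ∀ n i j → 0# ≤ fromℕ n * y ^ i * (fromℕ 2 - y) ^ j
    term≥0 n i j = *-nonNegative (*-nonNegative (fromℕ-nonNegative n) (^-nonNegative 0≤y i)) (^-nonNegative 0≤z j)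
    certificate≥0 : 0# ≤ ⟦ certificate ⟧ (y ∷ [])
    certificate≥0 = +-nonNegative
      (*-nonNegative (square-nonNegative _)
        (+-nonNegative (+-nonNegative (+-nonNegative (+-nonNegative (+-nonNegative
          (term≥0 25016683152427486953125 0 5) (term≥0 100299874389099430890625 1 4))
          (term≥0 165805374009145366031250 2 3)) (term≥0 139243844206620910281250 3 2))
          (term≥0 59488620507693787265625 4 1)) (term≥0 9975585995976763078125 5 0)))
      (+-nonNegative (*-nonNegative (fromℕ-nonNegative 255141047340840052568880) 0≤z)
                     (*-nonNegative (fromℕ-nonNegative 2445730699034762568880) 0≤y))

  -- The discretisation error

  -- A two-sided error bound survives a change of sign; negation swaps its two halves, which the
  -- induction mirrors.
  sign-stable : ∀ i {u v e} → u ≤ v + e → v ≤ u + e → (- 1#) ^ i * u ≤ (- 1#) ^ i * v + e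
  sign-stable zero    {u} {v} {e} u≤v+e v≤u+e = ≤-respˡ (sym (*-identityˡ u)) (≤-respʳ (+-congʳ (sym (*-identityˡ v))) u≤v+e)
  sign-stable (suc i) {u} {v} {e} u≤v+e v≤u+e = begin
    - 1# * s * u   ≈⟨ flip u ⟩
    s * - u        ≤⟨ sign-stable i (negate v≤u+e) (negate u≤v+e) ⟩
    s * - v + e    ≈⟨ +-congʳ (flip v) ⟨
    - 1# * s * v + e ∎
    where
    open ≤-Reasoning
    s : Carrier
    s = (- 1#) ^ i
    flip : ∀ x → - 1# * s * x ≈ s * - x
    flip x = solve 2 (λ s x → :- :1 :* s :* x := s :* :- x) refl s x
    negate : ∀ {x y} → x ≤ y + e → - y ≤ - x + e
    negate {x} {y} x≤y+e = ≤-by _ (x≤y⇒0≤y-x x≤y+e)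
      (solve 3 (λ x y e → :- x :+ e := :- y :+ ((y :+ e) :- x)) refl x y e)

  -- The last factor is `κ` at `y = 2`, its maximum on [0, 2].
  error : ℕ → ℕ
  error i = coefficient i ℕ.* slack i ℕ.* (12 ℕ.+ suc i ℕ.* 13)

  total-error : ℕ → ℕ
  total-error zero    = 0
  total-error (suc i) = total-error i ℕ.+ error i

  S-error : ∀ n h → S n (λ i → fromℕ (error i) * h) ≈ fromℕ (total-error n) * h
  S-error zero    h = sym (zeroˡ h)
  S-error (suc n) h = begin
    S n (λ i → fromℕ (error i) * h) + fromℕ (error n) * h ≈⟨ +-congʳ (S-error n h) ⟩
    fromℕ (total-error n) * h + fromℕ (error n) * h       ≈⟨ distribʳ h _ _ ⟨
    (fromℕ (total-error n) + fromℕ (error n)) * h         ≈⟨ *-congʳ (fromℕ-+ (total-error n) (error n)) ⟨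
    fromℕ (total-error (suc n)) * h                       ∎
    where open ≈-Reasoning

  κ-bounds : ∀ {y} → 0# ≤ y → y ≤ fromℕ 2 → ∀ i → 0# ≤ κ y i × κ y i ≤ fromℕ (12 ℕ.+ suc i ℕ.* 13)
  κ-bounds {y} 0≤y y≤2 i =
    +-nonNegative (fromℕ-nonNegative 12) (*-nonNegative (fromℕ-nonNegative (suc i))
      (+-nonNegative 0≤1 (*-nonNegative (fromℕ-nonNegative 6) 0≤y))) ,
    (begin
      fromℕ 12 + fromℕ (suc i) * (1# + fromℕ 6 * y)
        ≤⟨ +-monoʳ-≤ _ (*-monoʳ-≤ (fromℕ-nonNegative (suc i)) (+-monoʳ-≤ 1# (*-monoʳ-≤ (fromℕ-nonNegative 6) y≤2))) ⟩
      fromℕ 12 + fromℕ (suc i) * (1# + fromℕ 6 * fromℕ 2)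
        ≈⟨ solve 1 (λ i → con (+ 12) :+ i :* (:1 :+ con (+ 6) :* con (+ 2)) := con (+ 12) :+ i :* con (+ 13)) refl (fromℕ (suc i)) ⟩
      fromℕ 12 + fromℕ (suc i) * fromℕ 13
        ≈⟨ trans (fromℕ-+ 12 (suc i ℕ.* 13)) (+-congˡ (fromℕ-* (suc i) 13)) ⟨
      fromℕ (12 ℕ.+ suc i ℕ.* 13) ∎)
    where open ≤-Reasoning

  alternating-falling : ∀ {y h} n → 7 ℕ.≤ n → fromℕ n * h ≈ y → 0# ≤ h → y ≤ fromℕ 2 →
    alternating (falling y h) (κ y) ≤ alternating (y ^_) (κ y) + fromℕ 801024 * h
  alternating-falling {y} {h} n 7≤n nh≈y 0≤h y≤2 = begin
    alternating (falling y h) (κ y)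
      ≤⟨ S-mono-≤ 7 (λ i i<7 → term i (ℕ.≤-trans (ℕ.<⇒≤ i<7) 7≤n)) ⟩
    S 7 (λ i → (- 1#) ^ i * (fromℕ (coefficient i) * y ^ i * κ y i) + fromℕ (error i) * h)
      ≈⟨ S-+ 7 (λ i → (- 1#) ^ i * (fromℕ (coefficient i) * y ^ i * κ y i)) (λ i → fromℕ (error i) * h) ⟩
    alternating (y ^_) (κ y) + S 7 (λ i → fromℕ (error i) * h)
      -- `total-error 7` evaluates to 801024.
      ≈⟨ +-congˡ (S-error 7 h) ⟩
    alternating (y ^_) (κ y) + fromℕ 801024 * h ∎
    where
    open ≤-Reasoning
    0≤y : 0# ≤ y
    0≤y = ≤-respʳ nh≈y (*-nonNegative (fromℕ-nonNegative n) 0≤h)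
    term : ∀ i → i ℕ.≤ n → (- 1#) ^ i * (fromℕ (coefficient i) * falling y h i * κ y i) ≤
                           (- 1#) ^ i * (fromℕ (coefficient i) * y ^ i * κ y i) + fromℕ (error i) * h
    term i i≤n with _ , σ≤yⁱ , _ , yⁱ≤σ ← falling-bounds n nh≈y 0≤h y≤2 i i≤n
               with 0≤κ , κ≤κ₀ ← κ-bounds 0≤y y≤2 i = sign-stable i
      (≤-trans (*-monoˡ-≤ 0≤κ (*-monoʳ-≤ 0≤k σ≤yⁱ)) (≤-by _ (*-nonNegative (fromℕ-nonNegative (error i)) 0≤h) refl))
      (begin
        k * y ^ i * κ y i
          ≤⟨ *-monoˡ-≤ 0≤κ (*-monoʳ-≤ 0≤k yⁱ≤σ) ⟩
        k * (σ + K * h) * κ y i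
          ≈⟨ solve 5 (λ k σ K h κ → k :* (σ :+ K :* h) :* κ := k :* σ :* κ :+ k :* K :* h :* κ) refl k σ K h (κ y i) ⟩
        k * σ * κ y i + k * K * h * κ y i
          ≤⟨ +-monoʳ-≤ _ (*-monoʳ-≤ (*-nonNegative (*-nonNegative 0≤k (fromℕ-nonNegative (slack i))) 0≤h) κ≤κ₀) ⟩
        k * σ * κ y i + k * K * h * κ₀
          ≈⟨ +-congˡ (solve 4 (λ k K h κ → k :* K :* h :* κ := k :* K :* κ :* h) refl k K h κ₀) ⟩
        k * σ * κ y i + k * K * κ₀ * h
          ≈⟨ +-congˡ (*-congʳ (trans (fromℕ-* (coefficient i ℕ.* slack i) (12 ℕ.+ suc i ℕ.* 13))
               (*-congʳ (fromℕ-* (coefficient i) (slack i))))) ⟨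
        k * σ * κ y i + fromℕ (error i) * h ∎)
      where
      k K κ₀ σ : Carrier
      k  = fromℕ (coefficient i)
      K  = fromℕ (slack i)
      κ₀ = fromℕ (12 ℕ.+ suc i ℕ.* 13)
      σ  = falling y h i
      0≤k : 0# ≤ k
      0≤k = fromℕ-nonNegative (coefficient i)

  alternating-bound : ∀ {y h} n → 2000000000 ℕ.≤ n → fromℕ n * h ≈ y → 0# ≤ h → y ≤ fromℕ 2 →
    fromℕ 687500 * alternating (falling y h) (κ y) ≤ fromℕ 182718789120
  alternating-bound {y} {h} n N≤n nh≈y 0≤h y≤2 = begin
    fromℕ 687500 * alternating (falling y h) (κ y)
      ≤⟨ *-monoʳ-≤ (fromℕ-nonNegative 687500) (alternating-falling n (ℕ.≤-trans (ℕ.m≤m+n 7 1999999993) N≤n) nh≈y 0≤h y≤2) ⟩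
    fromℕ 687500 * (T + fromℕ 801024 * h)
      ≈⟨ trans (distribˡ _ _ _) (+-congˡ (trans (sym (*-assoc _ _ _)) (*-congʳ (sym (fromℕ-* 687500 801024))))) ⟩
    fromℕ 687500 * T + fromℕ 550704000000 * h
      ≤⟨ +-monoʳ-≤ _ small ⟩
    fromℕ 687500 * T + fromℕ 1000
      ≤⟨ taylor-bound 0≤y y≤2 ⟩
    fromℕ 182718789120 ∎
    where
    open ≤-Reasoning
    T : Carrier
    T = alternating (y ^_) (κ y)
    0≤y : 0# ≤ y
    0≤y = ≤-respʳ nh≈y (*-nonNegative (fromℕ-nonNegative n) 0≤h)
    -- The constant 687500 ∙ 801024 is rounded up to 10¹² = 500 ∙ 2 ∙ 10⁹, so that `n h = y ≤ 2`
    -- leaves at most 500 ∙ 2, the slack reserved in `taylor-bound`.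
    small : fromℕ 550704000000 * h ≤ fromℕ 1000
    small = begin
      fromℕ 550704000000 * h
        ≤⟨ *-monoˡ-≤ 0≤h (fromℕ-mono-≤ (ℕ.m≤m+n 550704000000 449296000000)) ⟩
      fromℕ (500 ℕ.* 2000000000) * h
        ≈⟨ trans (*-congʳ (fromℕ-* 500 2000000000)) (*-assoc _ _ _) ⟩
      fromℕ 500 * (fromℕ 2000000000 * h)
        ≤⟨ *-monoʳ-≤ (fromℕ-nonNegative 500) (*-monoˡ-≤ 0≤h (fromℕ-mono-≤ N≤n)) ⟩
      fromℕ 500 * (fromℕ n * h)
        ≤⟨ *-monoʳ-≤ (fromℕ-nonNegative 500) (≤-respˡ (sym nh≈y) y≤2) ⟩
      fromℕ 500 * fromℕ 2
        ≈⟨ fromℕ-* 500 2 ⟨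
      fromℕ 1000 ∎

  -1^*^ : ∀ h i → (- h) ^ i ≈ (- 1#) ^ i * h ^ i
  -1^*^ h zero    = sym (*-identityˡ 1#)
  -1^*^ h (suc i) = trans (*-congˡ (-1^*^ h i))
    (solve 3 (λ h s e → :- h :* (s :* e) := :- :1 :* s :* (h :* e)) refl h ((- 1#) ^ i) (h ^ i))

  ahead-alternating : ∀ {y h w} n → fromℕ n * h ≈ y → 0# ≤ h → h ≤ 1# → 0# ≤ w →
    fromℕ (8 !) * ahead w (1# - h) n ≤
    fromℕ (2 ℕ.+ n) * fromℕ (suc n) * alternating (falling y h) (λ i → 1# + fromℕ (suc i) * w)
  ahead-alternating {y} {h} {w} n nh≈y 0≤h h≤1 0≤w = begin
    fromℕ (8 !) * ahead w (1# - h) n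
      ≤⟨ *-monoʳ-≤ (fromℕ-nonNegative (8 !)) (ahead-bound n 0≤h h≤1 0≤w) ⟩
    fromℕ (8 !) * S 7 (λ i → (- h) ^ i * (g i * b i))
      ≈⟨ S-* 7 (fromℕ (8 !)) (λ i → (- h) ^ i * (g i * b i)) ⟨
    S 7 (λ i → fromℕ (8 !) * ((- h) ^ i * (g i * b i)))
      ≈⟨ S-cong 7 term ⟩
    S 7 (λ i → N * ((- 1#) ^ i * (fromℕ (coefficient i) * falling y h i * g i)))
      ≈⟨ S-* 7 N (λ i → (- 1#) ^ i * (fromℕ (coefficient i) * falling y h i * g i)) ⟩
    N * alternating (falling y h) g ∎
    where
    open ≤-Reasoning
    N : Carrier
    N = fromℕ (2 ℕ.+ n) * fromℕ (suc n)
    b g : ℕ → Carrier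
    b i = binomial (2 ℕ.+ n) (2 ℕ.+ i)
    g i = 1# + fromℕ (suc i) * w
    term : ∀ i → i ℕ.< 7 → fromℕ (8 !) * ((- h) ^ i * (g i * b i)) ≈
                           N * ((- 1#) ^ i * (fromℕ (coefficient i) * falling y h i * g i))
    term i i<7 = E.begin
      fromℕ (8 !) * ((- h) ^ i * (g i * b i))
        E.≈⟨ *-cong (trans (reflexive (≡.cong fromℕ (≡.sym (coefficient-! i i<7)))) (fromℕ-* (coefficient i) ((2 ℕ.+ i) !)))
               (*-congʳ (-1^*^ h i)) ⟩
      fromℕ (coefficient i) * fromℕ ((2 ℕ.+ i) !) * ((- 1#) ^ i * h ^ i * (g i * b i))
        E.≈⟨ solve 6 (λ k f s e g b → k :* f :* (s :* e :* (g :* b)) := s :* (k :* (f :* (b :* e)) :* g)) refl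
               (fromℕ (coefficient i)) (fromℕ ((2 ℕ.+ i) !)) ((- 1#) ^ i) (h ^ i) (g i) (b i) ⟩
      (- 1#) ^ i * (fromℕ (coefficient i) * (fromℕ ((2 ℕ.+ i) !) * (b i * h ^ i)) * g i)
        E.≈⟨ *-congˡ (*-congʳ (*-congˡ (binomial-falling n nh≈y i))) ⟩
      (- 1#) ^ i * (fromℕ (coefficient i) * (N * falling y h i) * g i)
        E.≈⟨ solve 5 (λ s k N σ g → s :* (k :* (N :* σ) :* g) := N :* (s :* (k :* σ :* g))) refl
               ((- 1#) ^ i) (fromℕ (coefficient i)) N (falling y h i) (g i) ⟩
      N * ((- 1#) ^ i * (fromℕ (coefficient i) * falling y h i * g i)) E.∎
      where module E = ≈-Reasoning

  -- Bounds on C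

  a : Carrier
  a = 11 / 6

  6a≈11 : fromℕ 6 * a ≈ fromℕ 11
  6a≈11 = fromℕ-*-/ 11 6

  /-nonNegative : ∀ m n .{{_ : ℕ.NonZero n}} → 0# ≤ m / n
  /-nonNegative m n = *-nonNegative (fromℕ-nonNegative m) (⁻¹-nonNegative (fromℕ-nonNegative n) (fromℕ≉0 n))

  0≤a : 0# ≤ a
  0≤a = /-nonNegative 11 6

  -- The factor 66 clears the denominators of both 11/6 and 6/11.
  66az≈121z : ∀ z → fromℕ 66 * (a * z) ≈ fromℕ 11 * (fromℕ 11 * z)
  66az≈121z z = trans (solve 2 (λ a z → con (+ 66) :* (a :* z) := con (+ 11) :* (con (+ 6) :* a :* z)) refl a z)
    (*-congˡ (*-congʳ 6a≈11))

  az≤1 : ∀ {z} → z ≤ 6 / 11 → a * z ≤ 1#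
  az≤1 {z} z≤6/11 = *-cancelˡ-fromℕ 66 (begin
    fromℕ 66 * (a * z)              ≈⟨ 66az≈121z z ⟩
    fromℕ 11 * (fromℕ 11 * z)       ≤⟨ *-monoʳ-≤ (fromℕ-nonNegative 11) (*-monoʳ-≤ (fromℕ-nonNegative 11) z≤6/11) ⟩
    fromℕ 11 * (fromℕ 11 * (6 / 11)) ≈⟨ *-congˡ (fromℕ-*-/ 6 11) ⟩
    fromℕ 11 * fromℕ 6              ≈⟨ solve 0 (con (+ 11) :* con (+ 6) := con (+ 66) :* :1) refl ⟩
    fromℕ 66 * 1#                   ∎)
    where open ≤-Reasoning

  1≤az : ∀ {z} → 6 / 11 ≤ z → 1# ≤ a * z
  1≤az {z} 6/11≤z = *-cancelˡ-fromℕ 66 (begin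
    fromℕ 66 * 1#                   ≈⟨ solve 0 (con (+ 11) :* con (+ 6) := con (+ 66) :* :1) refl ⟨
    fromℕ 11 * fromℕ 6              ≈⟨ *-congˡ (fromℕ-*-/ 6 11) ⟨
    fromℕ 11 * (fromℕ 11 * (6 / 11)) ≤⟨ *-monoʳ-≤ (fromℕ-nonNegative 11) (*-monoʳ-≤ (fromℕ-nonNegative 11) 6/11≤z) ⟩
    fromℕ 11 * (fromℕ 11 * z)       ≈⟨ 66az≈121z z ⟨
    fromℕ 66 * (a * z)              ∎)
    where open ≤-Reasoning

  F≈az : ∀ {z} → a * z ≤ 1# → F z ≈ a * z
  F≈az = x≤y⇒x⊓y≈x

  1-F≈0 : ∀ {z} → 6 / 11 ≤ z → 1# - F z ≈ 0#
  1-F≈0 6/11≤z = trans (+-congˡ (-‿cong (x≤y⇒y⊓x≈x (1≤az 6/11≤z)))) (-‿inverseʳ 1#)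

  F≤1 : ∀ z → F z ≤ 1#
  F≤1 z = x⊓y≤y (a * z) 1#

  0≤F : ∀ {z} → 0# ≤ z → 0# ≤ F z
  0≤F 0≤z = ⊓-glb (*-nonNegative 0≤a 0≤z) 0≤1

  F′≈a : ∀ {z} → z ≤ 6 / 11 → F′ z ≈ a
  F′≈a {z} z≤6/11 with z ≤? 6 / 11
  ... | yes _      = refl
  ... | no  z≰6/11 = contradiction z≤6/11 z≰6/11

  F′≈0 : ∀ {z} → ¬ (z ≤ 6 / 11) → F′ z ≈ 0#
  F′≈0 {z} z≰6/11 with z ≤? 6 / 11
  ... | yes z≤6/11 = contradiction z≤6/11 z≰6/11
  ... | no  _      = refl

  F′-bounds : ∀ z → 0# ≤ F′ z × F′ z ≤ a
  F′-bounds z with z ≤? 6 / 11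
  ... | yes _ = 0≤a , ≤-refl
  ... | no  _ = ≤-refl , 0≤a

  ahead-cong : ∀ {w w′} q n → w ≈ w′ → ahead w q n ≈ ahead w′ q n
  ahead-cong q n w≈w′ = S-cong (suc n) λ j _ → *-congˡ {x = q ^ j} (+-congʳ (*-congˡ w≈w′))

  -- Merges the contributions of the two coordinates into a single sum over a third family, given a
  -- termwise proportion.
  alternating-linear : ∀ f {g₁ g₂ g₃ : ℕ → Carrier} {t u} → (∀ i → t * (g₁ i + g₂ i) ≈ u * g₃ i) →
    t * (alternating f g₁ + alternating f g₂) ≈ u * alternating f g₃
  alternating-linear f {g₁} {g₂} {g₃} {t} {u} eq = begin
    t * (S 7 (term g₁) + S 7 (term g₂))    ≈⟨ *-congˡ (S-+ 7 (term g₁) (term g₂)) ⟨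
    t * S 7 (λ i → term g₁ i + term g₂ i)  ≈⟨ S-* 7 t (λ i → term g₁ i + term g₂ i) ⟨
    S 7 (λ i → t * (term g₁ i + term g₂ i)) ≈⟨ S-cong 7 (λ i _ → step i) ⟩
    S 7 (λ i → u * term g₃ i)              ≈⟨ S-* 7 u (term g₃) ⟩
    u * S 7 (term g₃)                      ∎
    where
    open ≈-Reasoning
    term : (ℕ → Carrier) → ℕ → Carrier
    term g i = (- 1#) ^ i * (fromℕ (coefficient i) * f i * g i)
    step : ∀ i → t * (term g₁ i + term g₂ i) ≈ u * term g₃ i
    step i = trans
      (solve 5 (λ t s k a b → t :* (s :* (k :* a) :+ s :* (k :* b)) := s :* (k :* (t :* (a :+ b)))) refl
        t ((- 1#) ^ i) (fromℕ (coefficient i) * f i) (g₁ i) (g₂ i))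
      (trans (*-congˡ (*-congˡ (eq i)))
        (solve 4 (λ u s k a → s :* (k :* (u :* a)) := u :* (s :* (k :* a))) refl
          u ((- 1#) ^ i) (fromℕ (coefficient i) * f i) (g₃ i)))

  module _ {x₁ x₂ : Carrier} (0≤x₁ : 0# ≤ x₁) (0≤x₂ : 0# ≤ x₂) (x₁+x₂≤1 : x₁ + x₂ ≤ 1#) (m : ℕ) where
    private
      n : ℕ
      n = suc m
      s z h q y N : Carrier
      s = 1# - x₁ - x₂
      z = s * fromℕ n ⁻¹
      -- Not `a * z`: the two agree once `y ≤ n`, whereas the bound outside the square is proved for
      -- every `m`.
      h = F z
      q = 1# - h
      y = a * s
      N = fromℕ (2 ℕ.+ n) * fromℕ (suc n)

      0≤s : 0# ≤ s
      0≤s = ≤-respʳ (solve 2 (λ x₁ x₂ → :1 :- (x₁ :+ x₂) := :1 :- x₁ :- x₂) refl x₁ x₂) (x≤y⇒0≤y-x x₁+x₂≤1)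

      0≤z : 0# ≤ z
      0≤z = *-nonNegative 0≤s (⁻¹-nonNegative (fromℕ-nonNegative n) (fromℕ≉0 n))

      C-formula : N * C m x₁ x₂ ≈ F′ x₁ * ahead (1# - F x₂) q n + F′ x₂ * ahead (1# - F x₁) q n
      C-formula = d-formula n _ (λ _ → ≡.refl)

      N-cancel : ∀ {u v} → N * u ≤ N * v → u ≤ v
      N-cancel {u} {v} Nu≤Nv = *-cancelˡ-fromℕ ((2 ℕ.+ n) ℕ.* suc n)
        (≤-respˡ (*-congʳ (sym (fromℕ-* (2 ℕ.+ n) (suc n)))) (≤-respʳ (*-congʳ (sym (fromℕ-* (2 ℕ.+ n) (suc n)))) Nu≤Nv))

      0≤1-F : ∀ x → 0# ≤ 1# - F x
      0≤1-F x = x≤y⇒0≤y-x (F≤1 x)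

      -- Uses `F′ x ≤ a` only, so it applies on whichever side of 6/11 the coordinate `x` lies.
      half-bound : ∀ x {w} → w ≈ 0# → fromℕ 12 * (F′ x * ahead w q n) ≤ N * fromℕ 11
      half-bound x {w} w≈0 = begin
        fromℕ 12 * (F′ x * ahead w q n)
          ≈⟨ *-congˡ (*-congˡ (ahead-cong q n w≈0)) ⟩
        fromℕ 12 * (F′ x * ahead 0# q n)
          ≈⟨ solve 2 (λ f A → con (+ 12) :* (f :* A) := con (+ 6) :* f :* (con (+ 2) :* A)) refl (F′ x) (ahead 0# q n) ⟩
        fromℕ 6 * F′ x * (fromℕ 2 * ahead 0# q n)
          ≤⟨ *-mono-≤ (*-nonNegative (fromℕ-nonNegative 6) (proj₁ (F′-bounds x)))
               (*-nonNegative (fromℕ-nonNegative (2 ℕ.+ n)) (fromℕ-nonNegative (suc n)))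
               (*-monoʳ-≤ (fromℕ-nonNegative 6) (proj₂ (F′-bounds x)))
               (ahead-0-bound n (0≤1-F z) q≤1) ⟩
        fromℕ 6 * a * N
          ≈⟨ trans (*-congʳ 6a≈11) (*-comm _ _) ⟩
        N * fromℕ 11 ∎
        where
        open ≤-Reasoning
        q≤1 : q ≤ 1#
        q≤1 = ≤-by h (0≤F 0≤z) (solve 1 (λ h → :1 := (:1 :- h) :+ h) refl h)

    C-bound-outside : ¬ (x₁ ≤ 6 / 11 × x₂ ≤ 6 / 11) → C m x₁ x₂ ≤ 11 / 12
    C-bound-outside outside = *-cancelˡ-fromℕ 12 (≤-respʳ (sym (fromℕ-*-/ 11 12)) (N-cancel (begin
      N * (fromℕ 12 * C m x₁ x₂)
        ≈⟨ solve 3 (λ N t C → N :* (t :* C) := t :* (N :* C)) refl N (fromℕ 12) (C m x₁ x₂) ⟩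
      fromℕ 12 * (N * C m x₁ x₂)
        ≈⟨ *-congˡ C-formula ⟩
      fromℕ 12 * (F′ x₁ * ahead (1# - F x₂) q n + F′ x₂ * ahead (1# - F x₁) q n)
        ≤⟨ cases ⟩
      N * fromℕ 11 ∎)))
      where
      open ≤-Reasoning
      ≰⇒≥ : ∀ {x} → ¬ (x ≤ 6 / 11) → 6 / 11 ≤ x
      ≰⇒≥ {x} x≰ with total x (6 / 11)
      ... | inj₁ x≤ = contradiction x≤ x≰
      ... | inj₂ x≥ = x≥
      cases : fromℕ 12 * (F′ x₁ * ahead (1# - F x₂) q n + F′ x₂ * ahead (1# - F x₁) q n) ≤ N * fromℕ 11
      cases = case (x₁ ≤? 6 / 11) ,′ (x₂ ≤? 6 / 11) of λ where
        (yes x₁≤ , yes x₂≤) → contradiction (x₁≤ , x₂≤) outside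
        (no x₁≰ , _) → ≤-respˡ
          (*-congˡ (sym (trans (+-congʳ (trans (*-congʳ (F′≈0 x₁≰)) (zeroˡ _))) (+-identityˡ _))))
          (half-bound x₂ (1-F≈0 (≰⇒≥ x₁≰)))
        (yes _ , no x₂≰) → ≤-respˡ
          (*-congˡ (sym (trans (+-congˡ (trans (*-congʳ (F′≈0 x₂≰)) (zeroˡ _))) (+-identityʳ _))))
          (half-bound x₁ (1-F≈0 (≰⇒≥ x₂≰)))

    C-bound-inside : 2000000000 ℕ.≤ m → x₁ ≤ 6 / 11 → x₂ ≤ 6 / 11 → C m x₁ x₂ ≤ 2014096 / 1000000
    C-bound-inside N≤m x₁≤ x₂≤ = *-cancelˡ-fromℕ 1000000 (≤-respʳ (sym (fromℕ-*-/ 2014096 1000000))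
      -- One factor 6 clears the `a` in front, the other the `a` inside the weights, and `8 !`
      -- clears the series coefficients.
      (*-cancelˡ-fromℕ (36 ℕ.* 8 !) (N-cancel (begin
        N * (fromℕ (36 ℕ.* 8 !) * (fromℕ 1000000 * C m x₁ x₂))
          ≈⟨ *-congˡ (*-congʳ (fromℕ-* 36 (8 !))) ⟩
        N * (fromℕ 36 * fromℕ (8 !) * (fromℕ 1000000 * C m x₁ x₂))
          ≈⟨ solve 5 (λ N t f M C → N :* (t :* f :* (M :* C)) := M :* (t :* (f :* (N :* C)))) refl
               N (fromℕ 36) (fromℕ (8 !)) (fromℕ 1000000) (C m x₁ x₂) ⟩
        fromℕ 1000000 * (fromℕ 36 * (fromℕ (8 !) * (N * C m x₁ x₂)))
          ≈⟨ *-congˡ (*-congˡ (*-congˡ (trans C-formula (+-cong (*-congʳ (F′≈a x₁≤)) (*-congʳ (F′≈a x₂≤)))))) ⟩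
        fromℕ 1000000 * (fromℕ 36 * (fromℕ (8 !) * (a * ahead w₂ q n + a * ahead w₁ q n)))
          ≈⟨ *-congˡ (solve 5 (λ t f a A B → t :* (f :* (a :* A :+ a :* B)) := t :* a :* (f :* A :+ f :* B)) refl
               (fromℕ 36) (fromℕ (8 !)) a (ahead w₂ q n) (ahead w₁ q n)) ⟩
        fromℕ 1000000 * (fromℕ 36 * a * (fromℕ (8 !) * ahead w₂ q n + fromℕ (8 !) * ahead w₁ q n))
          ≤⟨ *-monoʳ-≤ (fromℕ-nonNegative 1000000) (*-monoʳ-≤ (*-nonNegative (fromℕ-nonNegative 36) 0≤a)
               (+-mono-≤ (ahead-alternating n nh≈y (0≤F 0≤z) (F≤1 z) (0≤1-F x₂))
                         (ahead-alternating n nh≈y (0≤F 0≤z) (F≤1 z) (0≤1-F x₁)))) ⟩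
        fromℕ 1000000 * (fromℕ 36 * a * (N * alternating σ (g w₂) + N * alternating σ (g w₁)))
          ≈⟨ *-congˡ (trans (*-congˡ (sym (distribˡ N _ _)))
               (solve 3 (λ t N A → t :* (N :* A) := N :* (t :* A)) refl
                 (fromℕ 36 * a) N (alternating σ (g w₂) + alternating σ (g w₁)))) ⟩
        fromℕ 1000000 * (N * (fromℕ 36 * a * (alternating σ (g w₂) + alternating σ (g w₁))))
          ≈⟨ *-congˡ (*-congˡ (alternating-linear σ coefficients)) ⟩
        fromℕ 1000000 * (N * (fromℕ 11 * alternating σ (κ y)))
          ≈⟨ solve 4 (λ M N e A → M :* (N :* (e :* A)) := N :* (M :* e :* A)) refl
               (fromℕ 1000000) N (fromℕ 11) (alternating σ (κ y)) ⟩
        N * (fromℕ 1000000 * fromℕ 11 * alternating σ (κ y))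
          -- The common factor 16 of 10⁶ and 2014096 is split off, which leaves the reduced
          -- constants of `taylor-bound`.
          ≈⟨ *-congˡ (trans (*-congʳ (trans (sym (fromℕ-* 1000000 11)) (fromℕ-* 16 687500))) (*-assoc _ _ _)) ⟩
        N * (fromℕ 16 * (fromℕ 687500 * alternating σ (κ y)))
          ≤⟨ *-monoʳ-≤ (*-nonNegative (fromℕ-nonNegative (2 ℕ.+ n)) (fromℕ-nonNegative (suc n)))
               (*-monoʳ-≤ (fromℕ-nonNegative 16)
                 (alternating-bound n (ℕ.m≤n⇒m≤1+n N≤m) nh≈y (0≤F 0≤z) y≤2)) ⟩
        N * (fromℕ 16 * fromℕ 182718789120)
          ≈⟨ *-congˡ (trans (sym (fromℕ-* 16 182718789120)) (fromℕ-* (36 ℕ.* 8 !) 2014096)) ⟩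
        N * (fromℕ (36 ℕ.* 8 !) * fromℕ 2014096) ∎))))
      where
      open ≤-Reasoning
      w₁ w₂ : Carrier
      w₁ = 1# - F x₁
      w₂ = 1# - F x₂
      σ : ℕ → Carrier
      σ = falling y h
      g : Carrier → ℕ → Carrier
      g w i = 1# + fromℕ (suc i) * w

      y≤2 : y ≤ fromℕ 2
      y≤2 = *-cancelˡ-fromℕ 6 (begin
        fromℕ 6 * (a * s)  ≈⟨ trans (sym (*-assoc _ _ _)) (*-congʳ 6a≈11) ⟩
        fromℕ 11 * s       ≤⟨ *-monoʳ-≤ (fromℕ-nonNegative 11) (≤-by (x₁ + x₂) (+-nonNegative 0≤x₁ 0≤x₂)
                                (solve 2 (λ x₁ x₂ → :1 := (:1 :- x₁ :- x₂) :+ (x₁ :+ x₂)) refl x₁ x₂)) ⟩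
        fromℕ 11 * 1#      ≤⟨ ≤-by 1# 0≤1 (solve 0 (con (+ 6) :* con (+ 2) := con (+ 11) :* :1 :+ :1) refl) ⟩
        fromℕ 6 * fromℕ 2  ∎)

      naz≈y : fromℕ n * (a * z) ≈ y
      naz≈y = trans (solve 4 (λ n a s r → n :* (a :* (s :* r)) := a :* (s :* (n :* r))) refl (fromℕ n) a s (fromℕ n ⁻¹))
        (*-congˡ (trans (*-congˡ (⁻¹-inverseʳ (fromℕ n) (fromℕ≉0 n))) (*-identityʳ s)))

      nh≈y : fromℕ n * h ≈ y
      nh≈y = trans (*-congˡ (F≈az (*-cancelˡ-fromℕ n (begin
        fromℕ n * (a * z) ≈⟨ naz≈y ⟩
        y                 ≤⟨ y≤2 ⟩
        fromℕ 2           ≤⟨ fromℕ-mono-≤ (ℕ.≤-trans (ℕ.m≤m+n 2 1999999998) (ℕ.m≤n⇒m≤1+n N≤m)) ⟩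
        fromℕ n           ≈⟨ *-identityʳ _ ⟨
        fromℕ n * 1#      ∎)))) naz≈y

      coefficients : ∀ i → fromℕ 36 * a * (g w₂ i + g w₁ i) ≈ fromℕ 11 * κ y i
      coefficients i = E.begin
        fromℕ 36 * a * (g w₂ i + g w₁ i)
          E.≈⟨ *-congˡ (+-cong (+-congˡ (*-congˡ (+-congˡ (-‿cong (F≈az (az≤1 x₂≤))))))
                 (+-congˡ (*-congˡ (+-congˡ (-‿cong (F≈az (az≤1 x₁≤))))))) ⟩
        fromℕ 36 * a * ((1# + fromℕ (suc i) * (1# - a * x₂)) + (1# + fromℕ (suc i) * (1# - a * x₁)))
          -- Here `x₁` and `x₂` disappear individually: the sum of the weights is rewritten as
          -- `2 - a + a s`.
          E.≈⟨ solve 4 (λ a i x₁ x₂ →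
                 con (+ 36) :* a :* ((:1 :+ i :* (:1 :- a :* x₂)) :+ (:1 :+ i :* (:1 :- a :* x₁))) :=
                 con (+ 6) :* a :* (con (+ 12) :+ i :* (con (+ 12) :- con (+ 6) :* a :+ con (+ 6) :* (a :* (:1 :- x₁ :- x₂)))))
                 refl a (fromℕ (suc i)) x₁ x₂ ⟩
        fromℕ 6 * a * (fromℕ 12 + fromℕ (suc i) * (fromℕ 12 - fromℕ 6 * a + fromℕ 6 * y))
          E.≈⟨ *-cong 6a≈11 (+-congˡ (*-congˡ (+-congʳ (trans (+-congˡ (-‿cong 6a≈11))
                 (solve 0 (con (+ 12) :- con (+ 11) := :1) refl))))) ⟩
        fromℕ 11 * κ y i E.∎
        where module E = ≈-Reasoning

lemma6p6 : ∀ {c ℓ₁ ℓ₂} (ℝ : CompleteOrderedField c ℓ₁ ℓ₂) →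
    let open CompleteOrderedField ℝ
        open Real ℝ
    in ∀ (x₁ x₂ : Carrier) → 0# ≤ x₁ → 0# ≤ x₂ → x₁ + x₂ ≤ 1# →
       ∀ (C∞ : Carrier) → IsC∞ x₁ x₂ C∞ →
       ((x₁ ≤ 6 / 11 × x₂ ≤ 6 / 11) → C∞ ≤ 2014096 / 1000000) ×
       (¬ (x₁ ≤ 6 / 11 × x₂ ≤ 6 / 11) → C∞ ≤ 11 / 12)
lemma6p6 ℝ x₁ x₂ 0≤x₁ 0≤x₂ x₁+x₂≤1 C∞ C⟶C∞ =
  (λ (x₁≤ , x₂≤) → ⟶-eventually-≤ C⟶C∞ 2000000000 λ m N≤m → C-bound-inside 0≤x₁ 0≤x₂ x₁+x₂≤1 m N≤m x₁≤ x₂≤) ,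
  (λ outside → ⟶-eventually-≤ C⟶C∞ 0 λ m _ → C-bound-outside 0≤x₁ 0≤x₂ x₁+x₂≤1 m outside)
  where
  open Bounds ℝ
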